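{- For every integer $k\ge 4$, the graph $\mathcal{S}_k$ defined below (with incoming vertices $i_1,\dots,i_k$ and outgoing vertices $o_1,\dots,o_k$) is a $k$-in-out graph of optimal size, i.e. it is a $k$-in-out graph and no $k$-in-out graph has fewer vertices than $\mathcal{S}_k$ (which has $2k-1$ vertices).
   Context: All graphs are simple, finite, directed graphs. A Hamiltonian path from $u$ to $w$ is a directed simple path starting at $u$, ending at $w$, visiting every vertex exactly once. Let $S$ be a directed graph with $k$ distinct incoming vertices $i_1,\dots,i_k$ and $k$ distinct outgoing vertices $o_1,\dots,o_k$ (a vertex may be both). $S$ is a $k$-in-out graph if: (1) (paired vertices condition) for all $j,m\in\{1,\dots,k\}$ there is a Hamiltonian path in $S$ from $i_j$ to $o_m$ if and only if $j=m$; and (2) (single visit condition) there is no collection of two or more pairwise vertex-disjoint directed paths in $S$, each starting at an incoming vertex and finishing at an outgoing vertex (a single vertex that is both incoming and outgoing counts as such a path), whose union covers all vertices of $S$. "Undirected edge $(a,b)$" below means both directed edges $(a,b)$ and $(b,a)$. $\mathcal{S}_k$ ($k\ge4$) has vertex set $\{1,\dots,2k-1\}$. For even $k\ge4$: undirected edges $(4i-2,4i-1)$, $(4i-1,4i)$, $(4i,4i+1)$ for $i=1,\dots,\frac{k-2}{2}$; directed edges $(4i-2,4i+5)$ and $(4i+1,4i+2)$ for $i=1,\dots,\frac{k-4}{2}$; directed edges $(1,2)$, $(2k-6,2k-1)$, $(2k-3,2k-2)$, $(2k-2,1)$, $(2k-2,5)$, $(2k-1,2k-2)$. For odd $k\ge5$: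 undirected edges $(4i-2,4i-1)$, $(4i-1,4i)$, $(4i,4i+1)$ for $i=1,\dots,\frac{k-1}{2}$; directed edges $(4i-2,4i+5)$ and $(4i+1,4i+2)$ for $i=1,\dots,\frac{k-3}{2}$; directed edges $(1,2)$, $(2k-4,1)$, $(2k-2,5)$. In both cases $i_j=2j-1$ for $j=1,\dots,k$; $o_{2j}=4j+3$ and $o_{2j+1}=4j-3$ for $j=1,\dots,\lfloor\frac{k-3}{2}\rfloor$; for even $k$ additionally $o_1=3$, $o_{k-2}=2k-1$, $o_{k-1}=2k-7$, $o_k=2k-3$; for odd $k$ additionally $o_1=2k-1$, $o_{k-1}=3$, $o_k=2k-5$. -}

module Defs where

open import Data.Nat using (ℕ; zero; suc; _+_; _*_; _∸_; _≡ᵇ_; _≤_)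
open import Data.Nat.DivMod using (_/_; _%_)
open import Data.Bool using (Bool; true; false; if_then_else_; _∧_)
open import Data.Fin using (Fin; toℕ)
open import Data.List using (List; []; _∷_; _++_; map; concatMap; upTo; length)
open import Data.Bool.ListAction using (any)
open import Data.List.Relation.Unary.Unique.Propositional using (Unique)
open import Data.List.Relation.Unary.All using (All)
open import Data.List.Relation.Unary.Any using (Any)
open import Data.List.Relation.Unary.AllPairs using (AllPairs)
open import Data.List.Relation.Binary.Disjoint.Propositional using (Disjoint)
open import Data.List.Membership.Propositional using (_∈_)
open import Data.Product using (Σ; _×_; _,_)
open import Function.Definitions using (Injective)
open import Function.Bundles using (_⇔_)
open import Relation.Binary.PropositionalEquality using (_≡_)
open import Relation.Nullary using (¬_)

-- General notions.
-- A finite directed graph on vertex set Fin n is given by a Boolean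
-- adjacency function; adj u v ≡ true means the directed edge (u,v).

Adj : ℕ → Set
Adj n = Fin n → Fin n → Bool

-- simple: no loops (multiple edges are impossible in this encoding)
Simple : ∀ {n} → Adj n → Set
Simple {n} adj = (v : Fin n) → adj v v ≡ false

data Walk {n : ℕ} (adj : Adj n) : Fin n → Fin n → Set where
  [_]    : (v : Fin n) → Walk adj v v
  _∷⟨_⟩_ : (u : Fin n) {v w : Fin n} → adj u v ≡ true → Walk adj v w → Walk adj u w

vertices : ∀ {n} {adj : Adj n} {u w : Fin n} → Walk adj u w → List (Fin n)
vertices [ v ] = v ∷ []
vertices (u ∷⟨ _ ⟩ p) = u ∷ vertices p

IsSimplePath : ∀ {n} {adj : Adj n} {u w : Fin n} → Walk adj u w → Set
IsSimplePath p = Unique (vertices p)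

HamPath : ∀ {n} → Adj n → Fin n → Fin n → Set
HamPath {n} adj u w =
  Σ (Walk adj u w) λ p → IsSimplePath p × ((v : Fin n) → v ∈ vertices p)

IOPath : ∀ {k n} → Adj n → (Fin k → Fin n) → (Fin k → Fin n) → Set
IOPath {k} adj ins outs = Σ (Fin k) λ j → Σ (Fin k) λ m → Walk adj (ins j) (outs m)

ioVertices : ∀ {k n} {adj : Adj n} {ins outs : Fin k → Fin n} →
             IOPath adj ins outs → List (Fin n)
ioVertices (_ , _ , p) = vertices p

ioSimple : ∀ {k n} {adj : Adj n} {ins outs : Fin k → Fin n} →
           IOPath adj ins outs → Set
ioSimple (_ , _ , p) = IsSimplePath p

PairedVertices : ∀ {k n} → Adj n → (Fin k → Fin n) → (Fin k → Fin n) → Set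
PairedVertices {k} adj ins outs =
  (j m : Fin k) → HamPath adj (ins j) (outs m) ⇔ (j ≡ m)

SingleVisit : ∀ {k n} → Adj n → (Fin k → Fin n) → (Fin k → Fin n) → Set
SingleVisit {k} {n} adj ins outs =
  ¬ (Σ (List (IOPath adj ins outs)) λ ps →
       (2 ≤ length ps)
     × All ioSimple ps
     × AllPairs (λ p q → Disjoint (ioVertices p) (ioVertices q)) ps
     × ((v : Fin n) → Any (λ p → v ∈ ioVertices p) ps))

-- k-in-out graph: simple digraph with k distinct incoming vertices
-- ins j = i_{j+1} and k distinct outgoing vertices outs m = o_{m+1}
IsInOut : (k n : ℕ) → Adj n → (Fin k → Fin n) → (Fin k → Fin n) → Set
IsInOut k n adj ins outs =
    Simple adj × Injective _≡_ _≡_ ins × Injective _≡_ _≡_ outs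
  × PairedVertices adj ins outs × SingleVisit adj ins outs

-- The graph S_k.  Vertices are labelled 1..2k-1 in the paper; label ℓ
-- is the element of Fin (suc (2k-2)) with toℕ = ℓ - 1.

Sk-size : ℕ → ℕ
Sk-size k = suc (2 * k ∸ 2)   -- = 2k - 1 for k ≥ 1

range : ℕ → List ℕ
range r = map suc (upTo r)

undirected : ℕ → ℕ → List (ℕ × ℕ)
undirected a b = (a , b) ∷ (b , a) ∷ []

undEdges : ℕ → List (ℕ × ℕ)
undEdges i = undirected (4 * i ∸ 2) (4 * i ∸ 1)
          ++ undirected (4 * i ∸ 1) (4 * i)
          ++ undirected (4 * i) (4 * i + 1)

dirEdges : ℕ → List (ℕ × ℕ)
dirEdges i = (4 * i ∸ 2 , 4 * i + 5) ∷ (4 * i + 1 , 4 * i + 2) ∷ []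

isEven : ℕ → Bool
isEven k = k % 2 ≡ᵇ 0

SkEdges : ℕ → List (ℕ × ℕ)
SkEdges k =
  if isEven k
  then concatMap undEdges (range ((k ∸ 2) / 2))
    ++ concatMap dirEdges (range ((k ∸ 4) / 2))
    ++ (1 , 2) ∷ (2 * k ∸ 6 , 2 * k ∸ 1) ∷ (2 * k ∸ 3 , 2 * k ∸ 2)
     ∷ (2 * k ∸ 2 , 1) ∷ (2 * k ∸ 2 , 5) ∷ (2 * k ∸ 1 , 2 * k ∸ 2) ∷ []
  else concatMap undEdges (range ((k ∸ 1) / 2))
    ++ concatMap dirEdges (range ((k ∸ 3) / 2))
    ++ (1 , 2) ∷ (2 * k ∸ 4 , 1) ∷ (2 * k ∸ 2 , 5) ∷ []

label : ∀ {n} → Fin n → ℕ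
label v = suc (toℕ v)

SkAdj : (k : ℕ) → Adj (Sk-size k)
SkAdj k u v = any (λ { (a , b) → (a ≡ᵇ label u) ∧ (b ≡ᵇ label v) }) (SkEdges k)

-- element of Fin (suc N) with index i (only used with i ≤ N)
clamp : (N : ℕ) → ℕ → Fin (suc N)
clamp zero    _       = Fin.zero
clamp (suc N) zero    = Fin.zero
clamp (suc N) (suc i) = Fin.suc (clamp N i)

vtx : (k : ℕ) → ℕ → Fin (Sk-size k)
vtx k ℓ = clamp (2 * k ∸ 2) (ℓ ∸ 1)

-- i_j = 2j - 1  (j 1-based)
SkInLabel : ℕ → ℕ → ℕ
SkInLabel k j = 2 * j ∸ 1

-- o_m (m 1-based):
--  o_{2j} = 4j+3 = 2m+3,  o_{2j+1} = 4j-3 = 2m-5  for 1 ≤ j ≤ ⌊(k-3)/2⌋;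
--  even k: o_1 = 3, o_{k-2} = 2k-1, o_{k-1} = 2k-7, o_k = 2k-3;
--  odd k:  o_1 = 2k-1, o_{k-1} = 3, o_k = 2k-5.
SkOutLabel : ℕ → ℕ → ℕ
SkOutLabel k m =
  if isEven k
  then (if m ≡ᵇ 1 then 3
        else if m ≡ᵇ (k ∸ 2) then 2 * k ∸ 1
        else if m ≡ᵇ (k ∸ 1) then 2 * k ∸ 7
        else if m ≡ᵇ k then 2 * k ∸ 3
        else generic)
  else (if m ≡ᵇ 1 then 2 * k ∸ 1
        else if m ≡ᵇ (k ∸ 1) then 3
        else if m ≡ᵇ k then 2 * k ∸ 5
        else generic)
  where
  generic : ℕ
  generic = if isEven m then 2 * m + 3 else 2 * m ∸ 5

SkIn : (k : ℕ) → Fin k → Fin (Sk-size k)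
SkIn k j = vtx k (SkInLabel k (label j))

SkOut : (k : ℕ) → Fin k → Fin (Sk-size k)
SkOut k m = vtx k (SkOutLabel k (label m))

{-# OPTIONS --safe #-}
module Submission where

-- Optimality: along a Hamiltonian path from an incoming to an outgoing vertex, an outgoing
-- vertex is never directly followed by an incoming one, since cutting there would give two
-- covering paths. So each of the n − 1 consecutive pairs contributes at most one to the count
-- of outgoing sources plus incoming targets, and 2k ≤ n + 1.
--
-- For S_k, put label 1 + 4i + c (c = 0, 1, 2, 3) at Z i, A i, B i, C i. Then the graph is
-- bipartite and the Z's and B's are exactly the incoming and exactly the outgoing vertices;
-- they outnumber the others by one, and every path between them has one more of them than
-- of the others, so a covering family consists of a single path. Each Z or B has edges only
-- to its neighbours in the order of labels, so a Hamiltonian path ending at e moves up from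
-- every such vertex below e and down from every one above e. Excluding 2-cycles then leaves
-- two candidates for the start, and one of them would reach e after at most two steps.

open import Defs
open import Algebra.Properties.CommutativeSemigroup using (x∙yz≈y∙xz)
import Algebra.Solver.CommutativeMonoid as CommutativeMonoidSolver
open import Data.Bool using (Bool; true; false; if_then_else_) renaming (_≟_ to _≟ᵇ_)
open import Data.Bool.Properties using (T-≡; T-∧; ¬-not)
open import Data.Fin using (Fin; zero; suc; toℕ; fromℕ<)
open import Data.Fin.Properties using (any?; injective⇒≤; toℕ-fromℕ<; toℕ-injective; toℕ<n) renaming (_≟_ to _≟ᶠ_)
open import Data.List using (List; []; _∷_; _++_; concatMap; filter; length; lookup; map; tabulate; upTo)
open import Data.List.Membership.Propositional using (_∈_; find; lose)
open import Data.List.Membership.Propositional.Properties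
open import Data.List.Membership.Setoid.Properties using (index-injective)
open import Data.List.Properties using (filter-++; filter-reject; length-++; length-map; length-tabulate; length-upTo; map-++; upTo-∷ʳ; ++-assoc)
open import Data.List.Relation.Binary.Disjoint.Propositional using (Disjoint)
open import Data.List.Relation.Binary.Permutation.Propositional using (_↭_; refl; swap; ↭-refl; ↭-reflexive; ↭-sym; ↭-trans; ↭⇒↭ₛ; module PermutationReasoning)
import Data.List.Relation.Binary.Permutation.Propositional.Properties as ↭
import Data.List.Relation.Binary.Permutation.Setoid.Properties as ↭ₛ
open import Data.List.Relation.Unary.All as All using (All; []; _∷_)
import Data.List.Relation.Unary.All.Properties as All
open import Data.List.Relation.Unary.AllPairs using ([]; _∷_)
import Data.List.Relation.Unary.AllPairs.Properties as AllPairs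
open import Data.List.Relation.Unary.Any using (here; there; index)
import Data.List.Relation.Unary.Any.Properties as Any
open import Data.List.Relation.Unary.Unique.Propositional using (Unique)
import Data.List.Relation.Unary.Unique.Propositional.Properties as Unique
open import Data.Nat using (ℕ; zero; suc; _+_; _*_; _∸_; _≤_; _<_; z≤n; s≤s; s≤s⁻¹; _≤?_; _≡ᵇ_)
open import Data.Nat.DivMod using (_/_; m*n/n≡m)
open import Data.Nat.Properties
open import Data.Product using (Σ; ∃; ∃₂; _×_; _,_; proj₁; proj₂)
open import Data.Sum using (_⊎_; inj₁; inj₂)
open import Function using (_∘_; id)
open import Function.Bundles using (_⇔_; mk⇔; Equivalence)
open import Function.Definitions using (Injective)
open import Relation.Binary.PropositionalEquality using (_≡_; _≢_; refl; sym; trans; cong; cong₂; subst; subst₂; setoid; module ≡-Reasoning)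
open import Relation.Nullary using (¬_; Dec; yes; no; contradiction)
open import Relation.Nullary.Decidable using (True; toWitness)
open import Relation.Unary using (Decidable)

-- Counting in lists without repetition

lookup-injective : {A : Set} {xs : List A} → Unique xs → ∀ i j → lookup xs i ≡ lookup xs j → i ≡ j
lookup-injective (x∉ ∷ _) zero    zero    _  = refl
lookup-injective (x∉ ∷ _) zero    (suc j) eq = contradiction eq (All.lookup x∉ (∈-lookup j))
lookup-injective (x∉ ∷ _) (suc i) zero    eq = contradiction (sym eq) (All.lookup x∉ (∈-lookup i))
lookup-injective (_ ∷ u)  (suc i) (suc j) eq = cong suc (lookup-injective u i j eq)

-- A pigeonhole argument: sending an index of `xs` to the place of its element in `ys` is an
-- injection between finite index sets.
unique-⊆⇒length≤ : {A : Set} {xs ys : List A} → Unique xs → (∀ {x} → x ∈ xs → x ∈ ys) → length xs ≤ length ys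
unique-⊆⇒length≤ {A} {xs} uniq sub =
  injective⇒≤ {f = λ i → index (sub (∈-lookup i))} λ eq →
    lookup-injective uniq _ _ (index-injective (setoid A) (sub (∈-lookup _)) (sub (∈-lookup _)) eq)

covering⇒≤length : ∀ {n} {xs : List (Fin n)} → (∀ v → v ∈ xs) → n ≤ length xs
covering⇒≤length {n} {xs} cover =
  subst (_≤ length xs) (length-tabulate (λ i → i)) (unique-⊆⇒length≤ (Unique.allFin⁺ n) (λ _ → cover _))

unique⇒length≤ : ∀ {n} {xs : List (Fin n)} → Unique xs → length xs ≤ n
unique⇒length≤ {n} {xs} uniq =
  subst (length xs ≤_) (length-tabulate (λ i → i)) (unique-⊆⇒length≤ uniq (λ _ → ∈-allFin _))

unique-++⁻ : ∀ {A : Set} {xs ys : List A} → Unique (xs ++ ys) → Unique xs × Unique ys × Disjoint xs ys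
unique-++⁻ {xs = []} uniq = [] , uniq , λ { (() , _) }
unique-++⁻ {xs = x ∷ xs} (x∉ ∷ uniq) with unique-++⁻ {xs = xs} uniq
... | ux , uy , dis = All.tabulate (λ y∈ → All.lookup x∉ (∈-++⁺ˡ y∈)) ∷ ux , uy ,
  λ { (here refl , y∈) → All.lookup x∉ (∈-++⁺ʳ xs y∈) refl ; (there x∈ , y∈) → dis (x∈ , y∈) }

-- The lower bound

module LowerBound {k n : ℕ} {adj : Adj n} {ins outs : Fin k → Fin n} where

  Image : (Fin k → Fin n) → Fin n → Set
  Image f v = ∃ λ j → f j ≡ v

  image? : ∀ f → Decidable (Image f)
  image? f v = any? λ j → f j ≟ᶠ v

  image-count : ∀ {f xs} → Injective _≡_ _≡_ f → (∀ v → v ∈ xs) → k ≤ length (filter (image? f) xs)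
  image-count {f} {xs} f-inj cover =
    subst (_≤ length (filter (image? f) xs)) (length-tabulate f)
      (unique-⊆⇒length≤ (Unique.tabulate⁺ f-inj) λ x∈ → let (j , eq) = ∈-tabulate⁻ x∈ in
        ∈-filter⁺ (image? f) (cover _) (j , sym eq))

  Split : ∀ {u w} → Walk adj u w → Set
  Split {u} {w} p = ∃₂ λ x y → Image outs x × Image ins y ×
    Σ (Walk adj u x) λ p₁ → Σ (Walk adj y w) λ p₂ → vertices p ≡ vertices p₁ ++ vertices p₂

  #ins #outs : List (Fin n) → ℕ
  #ins  xs = length (filter (image? ins) xs)
  #outs xs = length (filter (image? outs) xs)

  filter-∷≤ : ∀ f x xs → length (filter (image? f) (x ∷ xs)) ≤ suc (length (filter (image? f) xs))
  filter-∷≤ f x xs with image? f x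
  ... | yes _ = ≤-refl
  ... | no  _ = m≤n⇒m≤1+n ≤-refl

  -- An edge from an outgoing to an incoming vertex cuts the path in two; if there is
  -- none, each consecutive pair contributes at most one to the two counts.
  split-or-count : ∀ {u w} (p : Walk adj u w) → Split p ⊎
    (#ins (vertices p) + #outs (vertices p) ≤ suc (length (vertices p)) ×
     (¬ Image ins u → #ins (vertices p) + #outs (vertices p) ≤ length (vertices p)))
  split-or-count [ v ] = inj₂ (+-mono-≤ (filter-∷≤ ins v []) (filter-∷≤ outs v []) , λ v∉ →
    subst (λ a → length a + #outs (v ∷ []) ≤ 1) (sym (filter-reject (image? ins) v∉)) (filter-∷≤ outs v []))
  split-or-count (_∷⟨_⟩_ u {v} e p) with split-or-count p
  ... | inj₁ (x , y , x∈ , y∈ , p₁ , p₂ , eq) = inj₁ (x , y , x∈ , y∈ , u ∷⟨ e ⟩ p₁ , p₂ , cong (u ∷_) eq)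
  ... | inj₂ (any-bound , bound) = by-cases (image? outs u) (image? ins v)
    where
    xs = vertices p
    ok : #ins xs + #outs (u ∷ xs) ≤ suc (length xs) →
      #ins (u ∷ xs) + #outs (u ∷ xs) ≤ suc (suc (length xs)) ×
      (¬ Image ins u → #ins (u ∷ xs) + #outs (u ∷ xs) ≤ suc (length xs))
    ok h = ≤-trans (+-mono-≤ (filter-∷≤ ins u xs) ≤-refl) (s≤s h) , λ u∉ →
      subst (λ a → length a + #outs (u ∷ xs) ≤ suc (length xs)) (sym (filter-reject (image? ins) u∉)) h
    by-cases : Dec (Image outs u) → Dec (Image ins v) → _
    by-cases (yes u∈) (yes v∈) = inj₁ (u , v , u∈ , v∈ , [ u ] , p , refl)
    -- Here `u` adds one to the outgoing count; the sharper bound for paths that do not start at an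
    -- incoming vertex makes room for it.
    by-cases (yes u∈) (no v∉) = inj₂ (ok (≤-trans (+-monoʳ-≤ (#ins xs) (filter-∷≤ outs u xs))
      (≤-trans (≤-reflexive (+-suc (#ins xs) _)) (s≤s (bound v∉)))))
    by-cases (no u∉) _ = inj₂ (ok (subst (λ a → #ins xs + length a ≤ suc (length xs))
      (sym (filter-reject (image? outs) u∉)) any-bound))

  -- The Hamiltonian path of index `j` visits all incoming and all outgoing vertices, so each count
  -- is at least `k`, and `single` rules out a split.
  2k≤1+n : (j : Fin k) → IsInOut k n adj ins outs → k + k ≤ suc n
  2k≤1+n j (_ , ins-inj , outs-inj , paired , single)
    with Equivalence.from (paired j j) refl
  ... | p , uniq , cover with split-or-count p
  ... | inj₂ (bound , _) = ≤-trans (+-mono-≤ (image-count ins-inj cover) (image-count outs-inj cover))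
          (≤-trans bound (s≤s (unique⇒length≤ uniq)))
  ... | inj₁ (_ , _ , (a , refl) , (b , refl) , p₁ , p₂ , eq)
    with unique-++⁻ {xs = vertices p₁} (subst Unique eq uniq)
  ... | u₁ , u₂ , dis = contradiction
          -- The cut supplies the two inner ends, the index `j` the two outer ones.
          ((j , a , p₁) ∷ (b , j , p₂) ∷ [] , s≤s (s≤s z≤n) , u₁ ∷ u₂ ∷ [] ,
           (dis ∷ []) ∷ [] ∷ [] , covered) single
    where
    covered : ∀ v → _
    covered v with ∈-++⁻ (vertices p₁) (subst (v ∈_) eq (cover v))
    ... | inj₁ v∈ = here v∈
    ... | inj₂ v∈ = there (here v∈)

-- The blocks of S_k

-- Block indices are unbounded, so one type serves all k; `size` says later which positions belong
-- to the graph.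
data Vertex : Set where
  Z A B C : ℕ → Vertex

pos : Vertex → ℕ
pos (Z i) = i * 4
pos (A i) = 1 + i * 4
pos (B i) = 2 + i * 4
pos (C i) = 3 + i * 4

next-block : Vertex → Vertex
next-block (Z i) = Z (suc i)
next-block (A i) = A (suc i)
next-block (B i) = B (suc i)
next-block (C i) = C (suc i)

at : ℕ → Vertex
at 0 = Z 0
at 1 = A 0
at 2 = B 0
at 3 = C 0
at (suc (suc (suc (suc n)))) = next-block (at n)

pos-next-block : ∀ v → pos (next-block v) ≡ 4 + pos v
pos-next-block (Z _) = refl
pos-next-block (A _) = refl
pos-next-block (B _) = refl
pos-next-block (C _) = refl

pos-at : ∀ n → pos (at n) ≡ n
pos-at 0 = refl
pos-at 1 = refl
pos-at 2 = refl
pos-at 3 = refl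
pos-at (suc (suc (suc (suc n)))) = trans (pos-next-block (at n)) (cong (4 +_) (pos-at n))

at-pos : ∀ v → at (pos v) ≡ v
at-pos (Z zero)    = refl
at-pos (Z (suc i)) = cong next-block (at-pos (Z i))
at-pos (A zero)    = refl
at-pos (A (suc i)) = cong next-block (at-pos (A i))
at-pos (B zero)    = refl
at-pos (B (suc i)) = cong next-block (at-pos (B i))
at-pos (C zero)    = refl
at-pos (C (suc i)) = cong next-block (at-pos (C i))

data Parity : Set where
  odd even : Parity

-- This is 2k - 1: `t` full blocks of four, then `Z t`, and for even k also `A t` and `B t`.
size : Parity → ℕ → ℕ
size odd  t = 1 + t * 4
size even t = 3 + t * 4

-- The edges of S_k for k = 2t + 1 (odd) and k = 2t + 2 (even). In the even case the last two
-- vertices P = 2k − 2 and Q = 2k − 1 are A t and B t.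
data Edge (t : ℕ) : Parity → Vertex → Vertex → Set where
  ZA  : ∀ {p i} → i < t → Edge t p (Z i) (A i)
  AB  : ∀ {p i} → i < t → Edge t p (A i) (B i)
  BA  : ∀ {p i} → i < t → Edge t p (B i) (A i)
  BC  : ∀ {p i} → i < t → Edge t p (B i) (C i)
  CB  : ∀ {p i} → i < t → Edge t p (C i) (B i)
  CZ  : ∀ {p i} → i < t → Edge t p (C i) (Z (suc i))
  ZC  : ∀ {p i} → i < t → Edge t p (Z (suc i)) (C i)
  AZ  : ∀ {p i} → suc i < t → Edge t p (A i) (Z (suc (suc i)))
  AZ₀ : ∀ {i} → suc i ≡ t → Edge t odd (A i) (Z 0)
  CZ₁ : ∀ {i} → suc i ≡ t → Edge t odd (C i) (Z 1)
  ZP  : ∀ {i} → i ≡ t → Edge t even (Z i) (A i)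
  AQ  : ∀ {i j} → suc i ≡ t → j ≡ t → Edge t even (A i) (B j)
  QP  : ∀ {i} → i ≡ t → Edge t even (B i) (A i)
  PZ₀ : ∀ {i} → i ≡ t → Edge t even (A i) (Z 0)
  PZ₁ : ∀ {i} → i ≡ t → Edge t even (A i) (Z 1)

-- The pairs (i_j , o_j).
data Partner (t : ℕ) : Parity → Vertex → Vertex → Set where
  ZZ  : ∀ {p i} → i < t → Partner t p (Z (suc i)) (Z i)
  BB  : ∀ {p i} → suc i < t → Partner t p (B i) (B (suc i))
  Z₀Z : ∀ {i} → i ≡ t → Partner t odd (Z 0) (Z i)
  BB₀ : ∀ {i} → suc i ≡ t → Partner t odd (B i) (B 0)
  Z₀B : Partner t even (Z 0) (B 0)
  BQ  : ∀ {i} → suc i ≡ t → Partner t even (B i) (B (suc i))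
  QZ  : ∀ {i} → i ≡ t → Partner t even (B i) (Z i)

-- Consecutive vertices on a path

data Path {V : Set} (E : V → V → Set) : V → V → List V → Set where
  [_] : ∀ x → Path E x x (x ∷ [])
  _∷_ : ∀ {x y z xs} → E x y → Path E y z xs → Path E x z (x ∷ xs)

data Next {V : Set} : List V → V → V → Set where
  here  : ∀ {x y xs} → Next (x ∷ y ∷ xs) x y
  there : ∀ {x y z xs} → Next xs x y → Next (z ∷ xs) x y

module _ {V : Set} where

  next-source : ∀ {xs} {x y : V} → Next xs x y → x ∈ xs
  next-source here      = here refl
  next-source (there n) = there (next-source n)

  next-target : ∀ {z xs} {x y : V} → Next (z ∷ xs) x y → y ∈ xs
  next-target here                    = here refl
  next-target (there {xs = _ ∷ _} n) = there (next-target n)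

  head-not-in-tail : ∀ {x : V} {xs} → Unique (x ∷ xs) → ¬ x ∈ xs
  head-not-in-tail (x∉ ∷ _) x∈ = All.lookup x∉ x∈ refl

  next-functional : ∀ {xs} {x y z : V} → Unique xs → Next xs x y → Next xs x z → y ≡ z
  next-functional u here here = refl
  next-functional u here (there n) = contradiction (next-source n) (head-not-in-tail u)
  next-functional u (there n) here = contradiction (next-source n) (head-not-in-tail u)
  next-functional (_ ∷ u) (there m) (there n) = next-functional u m n

  next-injective : ∀ {xs} {x y z : V} → Unique xs → Next xs x z → Next xs y z → x ≡ y
  next-injective u here here = refl
  next-injective (_ ∷ u) here (there n) = contradiction (next-target n) (head-not-in-tail u)
  next-injective (_ ∷ u) (there n) here = contradiction (next-target n) (head-not-in-tail u)
  next-injective (_ ∷ u) (there m) (there n) = next-injective u m n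

  next-asymmetric : ∀ {xs} {x y : V} → Unique xs → Next xs x y → ¬ Next xs y x
  next-asymmetric u here n = head-not-in-tail u (next-target n)
  next-asymmetric u (there m) here = head-not-in-tail u (there (next-target m))
  next-asymmetric (_ ∷ u) (there m) (there n) = next-asymmetric u m n

module _ {V : Set} {E : V → V → Set} where

  next-edge : ∀ {s e xs x y} → Path E s e xs → Next xs x y → E x y
  next-edge (e ∷ [ _ ])     here      = e
  next-edge (e ∷ (_ ∷ _))   here      = e
  next-edge (e ∷ p)         (there n) = next-edge p n

  successor : ∀ {s e xs x} → Path E s e xs → x ∈ xs → x ≡ e ⊎ ∃ λ y → Next xs x y
  successor [ _ ] (here eq) = inj₁ eq
  successor (_ ∷ [ _ ])   (here refl) = inj₂ (_ , here)
  successor (_ ∷ (_ ∷ _)) (here refl) = inj₂ (_ , here)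
  successor (_ ∷ p) (there x∈) with successor p x∈
  ... | inj₁ eq      = inj₁ eq
  ... | inj₂ (_ , n) = inj₂ (_ , there n)

  predecessor : ∀ {s e xs x} → Path E s e xs → x ∈ xs → x ≡ s ⊎ ∃ λ y → Next xs y x
  predecessor [ _ ] (here eq) = inj₁ eq
  predecessor (_ ∷ p) (here eq) = inj₁ eq
  predecessor (_ ∷ p) (there x∈) with predecessor p x∈ | p
  ... | inj₁ refl    | [ _ ] = inj₂ (_ , here)
  ... | inj₁ refl    | _ ∷ _ = inj₂ (_ , here)
  ... | inj₂ (_ , n) | _     = inj₂ (_ , there n)

  end-∈ : ∀ {s e xs} → Path E s e xs → e ∈ xs
  end-∈ [ _ ]   = here refl
  end-∈ (_ ∷ p) = there (end-∈ p)

  closed-path : ∀ {s xs} → Path E s s xs → Unique xs → xs ≡ s ∷ []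
  closed-path [ _ ]   _ = refl
  closed-path (_ ∷ p) u = contradiction (end-∈ p) (head-not-in-tail u)

  uncons : ∀ {s e xs x} → Path E s e xs → Unique xs → Next xs s x →
           ∃ λ ys → xs ≡ s ∷ ys × Path E x e ys × Unique ys
  uncons (_ ∷ p@([ _ ]))   (_ ∷ u) here = _ , refl , p , u
  uncons (_ ∷ p@(_ ∷ _)) (_ ∷ u) here = _ , refl , p , u
  uncons p@(_ ∷ _) u (there n) = contradiction (next-source n) (head-not-in-tail u)

  -- Each step peels off the head of the list, and a path without repetitions that starts at its own
  -- end is a single vertex, so nothing follows `e`.
  two-step-path : ∀ {s x e xs} → Path E s e xs → Unique xs → Next xs s x → Next xs x e → xs ≡ s ∷ x ∷ e ∷ []
  two-step-path p u m n with uncons p u m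
  two-step-path p u m here | _ , refl , _ = contradiction m (next-asymmetric u m)
  two-step-path p u m (there n) | _ , refl , q , v with uncons q v n
  ... | _ , refl , r , w with refl ← closed-path r w = refl

-- Uniqueness of the starting vertex

record Tour (p : Parity) (t : ℕ) (s e : Vertex) : Set where
  field
    {route} : List Vertex
    path    : Path (Edge t p) s e route
    unique  : Unique route
    cover   : ∀ v → pos v < size p t → v ∈ route

-- The implicit `True (c ≤? 4)` is settled by evaluation, so each use passes only a numeral.
offset : ∀ c {c≤4 : True (c ≤? 4)} {i j} → i < j → c + i * 4 ≤ j * 4
offset c {c≤4} i<j = ≤-trans (+-monoˡ-≤ _ (toWitness c≤4)) (*-monoˡ-≤ 4 i<j)

blocks-fit : ∀ p t → t * 4 < size p t
blocks-fit odd  t = ≤-refl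
blocks-fit even t = m≤n⇒m≤1+n (m≤n⇒m≤1+n ≤-refl)

module _ {p t s e} (T : Tour p t s e) where
  open Tour T

  infix 4 _⇒_
  _⇒_ : Vertex → Vertex → Set
  x ⇒ y = Next route x y

  fun : ∀ {x y z} → x ⇒ y → x ⇒ z → y ≡ z
  fun = next-functional unique

  inj : ∀ {x y z} → x ⇒ z → y ⇒ z → x ≡ y
  inj = next-injective unique

  asym : ∀ {x y} → x ⇒ y → ¬ (y ⇒ x)
  asym = next-asymmetric unique

  edge : ∀ {x y} → x ⇒ y → Edge t p x y
  edge = next-edge path

  out : ∀ v → pos v < size p t → v ≡ e ⊎ ∃ λ y → v ⇒ y
  out v v< = successor path (cover v v<)

  into : ∀ v → pos v < size p t → v ≡ s ⊎ ∃ λ y → y ⇒ v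
  into v v< = predecessor path (cover v v<)

  size≤length : size p t ≤ length route
  size≤length = subst (_≤ length route) (length-upTo _)
    (≤-trans (unique-⊆⇒length≤ (Unique.upTo⁺ _) λ {x} x∈ →
       subst (_∈ map pos route) (pos-at x) (∈-map⁺ pos (cover (at x) (subst (_< _) (sym (pos-at x)) (∈-upTo⁻ x∈)))))
     (≤-reflexive (length-map pos route)))

  size≥5 : 0 < t → 5 ≤ size p t
  size≥5 0<t = ≤-trans (s≤s (offset 4 0<t)) (blocks-fit p t)

  not-trivial : 0 < t → s ≢ e
  not-trivial 0<t refl with closed-path path unique | size≤length
  ... | refl | ≤1 with s≤s () ← ≤-trans (size≥5 0<t) ≤1

  -- Such a route would have three vertices, while one full block already forces at least five.
  not-two-steps : ∀ {x} → 0 < t → s ⇒ x → ¬ (x ⇒ e)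
  not-two-steps 0<t m n with two-step-path path unique m n | size≤length
  ... | refl | ≤3 with s≤s (s≤s (s≤s ())) ← ≤-trans (size≥5 0<t) ≤3

  below-end : ∀ v → pos v < pos e → pos e < size p t → ∃ λ y → v ⇒ y
  below-end v v<e e< with out v (<-trans v<e e<)
  ... | inj₁ refl = contradiction v<e (n≮n _)
  ... | inj₂ next = next

  above-end : ∀ v → pos e < pos v → pos v < size p t → ∃ λ y → v ⇒ y
  above-end v e<v v< with out v v<
  ... | inj₁ refl = contradiction e<v (n≮n _)
  ... | inj₂ next = next

  module _ (e< : pos e < size p t) where
    -- Upward induction along `Z 0`, `B 0`, `Z 1`, `B 1`, and so on. Each of these has only its
    -- label neighbours as targets, and the lower one is already the successor of the vertex treated
    -- before. `Z 0` has no lower neighbour, which starts the induction.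
    up-Z : ∀ j → pos (Z j) < pos e → Z j ⇒ A j
    up-B : ∀ j → pos (B j) < pos e → B j ⇒ C j
    up-Z j lt with below-end (Z j) lt e<
    ... | _ , n with edge n
    ... | ZA _ = n
    ... | ZP _ = n
    up-Z (suc j) lt | _ , n | ZC _ with () ← inj n (up-B j (≤-trans (s≤s (m≤n+m _ 2)) lt))
    up-B j lt with below-end (B j) lt e<
    ... | _ , n with edge n
    ... | BC _ = n
    ... | BA _ with () ← inj n (up-Z j (<-trans (s≤s (m≤n+m _ 1)) lt))
    ... | QP _ with () ← inj n (up-Z j (<-trans (s≤s (m≤n+m _ 1)) lt))

  within : ∀ c {c≤4 : True (c ≤? 4)} {j} → j < t → c + j * 4 < size p t
  within c {c≤4} j<t = ≤-trans (s≤s (offset c {c≤4} j<t)) (blocks-fit p t)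

  private
    -- The start of the downward induction for even k: the last vertex Q can only move to P.
    QP⇒ : ∀ {i} → i ≡ t → pos e < pos (B i) → p ≡ even → B i ⇒ A i
    QP⇒ refl lt refl with above-end (B t) lt ≤-refl
    ... | _ , n with edge n
    ... | BA _   = n
    ... | QP _   = n
    ... | BC t<t = contradiction t<t (n≮n _)

    -- The mirror image, from the top down: the upper neighbour is already the successor of the
    -- vertex treated before. For odd k it starts at `Z t`, which has no upper neighbour. `d` counts
    -- the blocks above block `j`, which makes the recursion structural.
    down-Z′ : ∀ d j → d + suc j ≡ t → pos e < pos (Z (suc j)) → Z (suc j) ⇒ C j
    down-B′ : ∀ d j → d + suc j ≡ t → pos e < pos (B j) → B j ⇒ A j
    down-Z′ d j refl lt with above-end (Z (suc j)) lt (within 4 (m≤n+m _ d))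
    ... | _ , n with edge n
    ... | ZC _ = n
    ... | ZP eq with () ← inj n (QP⇒ eq (≤-trans lt (m≤n+m _ 2)) refl)
    down-Z′ zero    j refl lt | _ , n | ZA lt′ = contradiction lt′ (n≮n _)
    down-Z′ (suc d) j refl lt | _ , n | ZA _
      with () ← inj n (down-B′ d (suc j) (+-suc d (suc j)) (≤-trans lt (m≤n+m _ 2)))
    down-B′ d j eq lt with above-end (B j) lt (within 2 (subst (j <_) eq (m≤n+m _ d)))
    ... | _ , n with edge n
    ... | BA _ = n
    ... | QP _ = n
    ... | BC _ with () ← inj n (down-Z′ d j eq (≤-trans lt (m≤n+m _ 2)))

  down-Z : ∀ {j} → j < t → pos e < pos (Z (suc j)) → Z (suc j) ⇒ C j
  down-Z {j} j<t = down-Z′ (t ∸ suc j) j (m∸n+n≡m j<t)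

  down-B : ∀ {j} → j < t → pos e < pos (B j) → B j ⇒ A j
  down-B {j} j<t = down-B′ (t ∸ suc j) j (m∸n+n≡m j<t)

-- This is k ≥ 4 in terms of `t`: k = 2t + 1 needs `t` at least 2, and k = 2t + 2 needs `t` at least
-- 1.
Large : Parity → ℕ → Set
Large odd  t = 1 < t
Large even t = 0 < t

large⇒0< : ∀ {p t} → Large p t → 0 < t
large⇒0< {odd}  1<t = <⇒≤ 1<t
large⇒0< {even} 0<t = 0<t

-- If the edge CZ₁ were used, C 0 would have lost both its possible successors.
no-chord : ∀ {t s e i} (T : Tour odd t s e) → 1 < t → pos e < size odd t → pos (B 0) < pos e → C 0 ≢ e → i ≢ 0 →
           ¬ (_⇒_ T (C i) (Z 1))
no-chord {e = e} T 1<t e< B<e C≢e i≢0 chord with out T (C 0) (within T 3 (<⇒≤ 1<t))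
... | inj₁ eq = C≢e eq
... | inj₂ (_ , n) with edge T n
... | CB _    = asym T n (up-B T e< 0 B<e)
... | CZ _ with refl ← inj T n chord = i≢0 refl
... | CZ₁ eq  = <⇒≢ 1<t eq

-- All cases follow one scheme. If `s` is not the start, it has a predecessor; a label neighbour to
-- which `s` itself moves is excluded as a 2-cycle, and one vertex y remains. Another vertex v
-- thereby loses y as predecessor, and its remaining predecessors, if any, would close 2-cycles with
-- its own forced move, so the route starts at v. From v the end is reached in at most two steps,
-- against the size of the graph.
start-unique : ∀ {p t s s′ e} → Large p t → Partner t p s e → Tour p t s′ e → s′ ≡ s
start-unique {p} {t} large (ZZ {i = i} i<t) T with into T (Z (suc i)) (within T 4 i<t)
... | inj₁ eq = sym eq
... | inj₂ (_ , n) with edge T n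
... | CZ _ = contradiction (down-Z T i<t (m≤n+m _ 3)) (asym T n)
start-unique {p} {t} large (ZZ i<t) T | inj₂ (_ , n) | AZ {i = i} _ with into T (B i) (within T 2 (<⇒≤ i<t))
... | inj₂ (_ , m) with edge T m
...   | AB _    with () ← fun T n m
...   | CB _    = contradiction m (asym T (up-B T (within T 0 i<t) i (m≤n+m _ 1)))
...   | AQ _ eq = contradiction eq (<⇒≢ (<⇒≤ i<t))
-- The rival start `B i` is forced through `C i` to `Z (suc i)`, which is the end.
start-unique {p} {t} large (ZZ i<t) T | inj₂ (_ , n) | AZ {i = i} _ | inj₁ refl
  with up-B T (within T 0 i<t) i (m≤n+m _ 1) | out T (C i) (within T 3 (<⇒≤ i<t))
... | BC′ | inj₂ (_ , m) with edge T m
...   | CB _   = contradiction BC′ (asym T m)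
...   | CZ _   = contradiction m (not-two-steps T (large⇒0< large) BC′)
...   | CZ₁ eq = contradiction eq (<⇒≢ i<t)
start-unique large (ZZ i<t) T | inj₂ (_ , n) | CZ₁ {i} refl with into T (B i) (within T 2 ≤-refl)
... | inj₂ (_ , m) with edge T m
...   | CB _ with () ← fun T n m
...   | AB _ = contradiction m (asym T (down-B T ≤-refl (s≤s z≤n)))
-- The end is `Z 0`, and the rival start `B i` of the last block is forced down to `A i`, whose only
-- other target is `Z 0`.
start-unique large (ZZ i<t) T | inj₂ (_ , n) | CZ₁ {i} refl | inj₁ refl
  with down-B T ≤-refl (s≤s z≤n) | out T (A i) (within T 1 ≤-refl)
... | BA′ | inj₂ (_ , m) with edge T m
...   | AB _  = contradiction BA′ (asym T m)
...   | AZ lt = contradiction lt (n≮n _)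
...   | AZ₀ _ = contradiction m (not-two-steps T (s≤s z≤n) BA′)
-- The end `Z 0` has P as its only predecessor, and P is spent on `Z 1`; the rival start would be
-- the end itself.
start-unique {t = t} large (ZZ i<t) T | inj₂ (_ , n) | PZ₁ refl with into T (Z 0) (s≤s z≤n)
... | inj₁ eq = contradiction (sym eq) (not-trivial T large)
... | inj₂ (_ , m) with edge T m
...   | PZ₀ refl with () ← fun T n m
start-unique {p} {t} large (BB {i = i} lt) T with into T (B i) (within T 2 (<⇒≤ lt))
... | inj₁ eq = sym eq
... | inj₂ (_ , n) with edge T n
... | CB _    = contradiction n (asym T (up-B T (within T 2 lt) i (m≤n+m _ 3)))
... | AQ _ eq = contradiction eq (<⇒≢ (<⇒≤ lt))
... | AB _ with into T (Z (suc (suc i))) (within T 4 lt)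
...   | inj₂ (_ , m) with edge T m
...     | CZ _ = contradiction (down-Z T lt (m≤n+m _ 1)) (asym T m)
...     | AZ _ with () ← fun T n m
-- The rival start `Z (suc (suc i))` is forced through `C (suc i)` to the end `B (suc i)`; the long
-- edge back to `Z 1` is excluded by `no-chord`.
start-unique {p} {t} large (BB {i = i} lt) T | inj₂ (_ , n) | AB _ | inj₁ refl
  with down-Z T lt (m≤n+m _ 1) | out T (C (suc i)) (within T 3 lt)
... | ZC′ | inj₂ (_ , m) with edge T m
...   | CB _  = contradiction m (not-two-steps T (large⇒0< large) ZC′)
...   | CZ _  = contradiction m (asym T ZC′)
...   | CZ₁ _ = contradiction m (no-chord T large (within T 2 lt) (s≤s (s≤s (s≤s z≤n))) (λ ()) λ ())
start-unique {t = suc (suc u)} (s≤s large) (Z₀Z refl) T with into T (Z 0) (s≤s z≤n)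
... | inj₁ eq = sym eq
... | inj₂ (_ , n) with edge T n
... | AZ₀ refl with into T (B (suc u)) (within T 2 ≤-refl)
...   | inj₂ (_ , m) with edge T m
...     | AB _ with () ← fun T n m
...     | CB _ = contradiction m (asym T (up-B T ≤-refl (suc u) (m≤n+m _ 1)))
start-unique {t = suc (suc u)} (s≤s large) (Z₀Z refl) T | inj₂ (_ , n) | AZ₀ refl | inj₁ refl
  with up-B T ≤-refl (suc u) (m≤n+m _ 1) | out T (C (suc u)) (within T 3 ≤-refl)
... | BC′ | inj₂ (_ , m) with edge T m
...   | CB _   = contradiction m (asym T BC′)
...   | CZ _   = contradiction m (not-two-steps T (s≤s z≤n) BC′)
...   | CZ₁ _  = contradiction m (no-chord T (s≤s (s≤s z≤n)) ≤-refl (s≤s (s≤s (s≤s z≤n))) (λ ()) λ ())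
start-unique {t = suc (suc u)} (s≤s large) (BB₀ refl) T with into T (B (suc u)) (within T 2 ≤-refl)
... | inj₁ eq = sym eq
... | inj₂ (_ , n) with edge T n
... | AB _ = contradiction n (asym T (down-B T ≤-refl (s≤s (s≤s (s≤s z≤n)))))
... | CB _ with into T (Z 1) (within T 4 (s≤s z≤n))
...   | inj₂ (_ , m) with edge T m
...     | CZ _ = contradiction m (asym T (down-Z T (s≤s z≤n) (m≤n+m _ 1)))
...     | CZ₁ refl with () ← fun T n m
start-unique {t = suc (suc u)} (s≤s large) (BB₀ refl) T | inj₂ (_ , n) | CB _ | inj₁ refl
  with down-Z T (s≤s z≤n) (m≤n+m _ 1) | out T (C 0) (within T 3 (s≤s z≤n))
... | ZC′ | inj₂ (_ , m) with edge T m
...   | CB _   = contradiction m (not-two-steps T (s≤s z≤n) ZC′)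
...   | CZ _   = contradiction m (asym T ZC′)
start-unique large Z₀B T with into T (Z 0) (s≤s z≤n)
... | inj₁ eq = sym eq
... | inj₂ (_ , n) with edge T n
... | PZ₀ refl with into T (Z 1) (within T 4 large)
...   | inj₂ (_ , m) with edge T m
...     | CZ _ = contradiction m (asym T (down-Z T large (m≤n+m _ 1)))
...     | PZ₁ refl with () ← fun T n m
start-unique large Z₀B T | inj₂ (_ , n) | PZ₀ refl | inj₁ refl
  with down-Z T large (m≤n+m _ 1) | out T (C 0) (within T 3 large)
... | ZC′ | inj₂ (_ , m) with edge T m
...   | CB _   = contradiction m (not-two-steps T large ZC′)
...   | CZ _   = contradiction m (asym T ZC′)
start-unique large (BQ {i} refl) T with into T (B i) (within T 2 ≤-refl)
... | inj₁ eq = sym eq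
... | inj₂ (_ , n) with edge T n
... | CB _    = contradiction n (asym T (up-B T ≤-refl i (m≤n+m _ 3)))
... | AQ _ ()
... | AB _ with into T (B (suc i)) ≤-refl
...   | inj₁ eq = contradiction (sym eq) (not-trivial T large)
...   | inj₂ (_ , m) with edge T m
...     | AB lt = contradiction lt (n≮n _)
...     | CB lt = contradiction lt (n≮n _)
...     | AQ refl _ with () ← fun T n m
start-unique {t = suc u} large (QZ refl) T with into T (B (suc u)) ≤-refl
... | inj₁ eq = sym eq
... | inj₂ (_ , n) with edge T n
... | AB lt = contradiction lt (n≮n _)
... | CB lt = contradiction lt (n≮n _)
... | AQ refl _ with into T (B u) (within T 2 ≤-refl)
...   | inj₂ (_ , m) with edge T m
...     | AB _ with () ← fun T n m
...     | CB _ = contradiction m (asym T (up-B T (blocks-fit even (suc u)) u (m≤n+m _ 1)))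
...     | AQ _ ()
start-unique {t = suc u} large (QZ refl) T | inj₂ (_ , n) | AQ refl _ | inj₁ refl
  with up-B T (blocks-fit even (suc u)) u (m≤n+m _ 1) | out T (C u) (within T 3 ≤-refl)
... | BC′ | inj₂ (_ , m) with edge T m
...   | CB _   = contradiction m (asym T BC′)
...   | CZ _   = contradiction m (not-two-steps T large BC′)

-- The Hamiltonian paths

climb : ℕ → List Vertex
climb zero    = Z 0 ∷ []
climb (suc i) = climb i ++ A i ∷ B i ∷ C i ∷ Z (suc i) ∷ []

-- Each block is run downwards while the block index rises: the edge from `A i` to `Z (suc (suc i))`
-- leads to the next block.
descend : ℕ → ℕ → List Vertex
descend i zero    = []
descend i (suc d) = Z (suc i) ∷ C i ∷ B i ∷ A i ∷ descend (suc i) d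

-- What lies between the `A` of the last block and `Z 0`: nothing for odd k, and Q, P for even k.
bridge : Parity → ℕ → List Vertex
bridge odd  t = []
bridge even t = B t ∷ A t ∷ []

exit : Parity → ℕ → Vertex
exit odd  t = Z 0
exit even t = B t

open CommutativeMonoidSolver (↭.++-commutativeMonoid {A = Vertex}) using (solve; _⊜_; _⊕_)

-- The block `Z (suc i)`, `C i`, `B i`, `A i` is the reverse of the one that extends `climb i` to
-- `climb (suc i)`.
climb-descend : ∀ d i → climb i ++ descend i d ↭ climb (d + i)
climb-descend zero    i = ↭.++-identityʳ (climb i)
climb-descend (suc d) i = ↭-trans
  (solve 6 (λ k z c b a r → k ⊕ (z ⊕ (c ⊕ (b ⊕ (a ⊕ r)))) ⊜ (k ⊕ (a ⊕ (b ⊕ (c ⊕ z)))) ⊕ r) refl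
     (climb i) (Z (suc i) ∷ []) (C i ∷ []) (B i ∷ []) (A i ∷ []) (descend (suc i) d))
  (subst (λ m → climb (suc i) ++ descend (suc i) d ↭ climb m) (+-suc d i) (climb-descend d (suc i)))

module _ {V : Set} {E : V → V → Set} where

  join : ∀ {x y z w xs ys} → Path E x y xs → E y z → Path E z w ys → Path E x w (xs ++ ys)
  join [ _ ]   f q = f ∷ q
  join (e ∷ p) f q = e ∷ join p f q

  start-∈ : ∀ {s e xs} → Path E s e xs → s ∈ xs
  start-∈ [ _ ]   = here refl
  start-∈ (_ ∷ _) = here refl

climb-path : ∀ {p t} i → i ≤ t → Path (Edge t p) (Z 0) (Z i) (climb i)
climb-path zero    _   = [ _ ]
climb-path (suc i) i<t = join (climb-path i (<⇒≤ i<t)) (ZA i<t) (AB i<t ∷ BC i<t ∷ CZ i<t ∷ [ _ ])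

bridge-path : ∀ p {t i} → i ≤ t → Path (Edge t p) (exit p t) (Z i) (bridge p t ++ climb i)
bridge-path odd  i≤t = climb-path _ i≤t
bridge-path even i≤t = QP refl ∷ PZ₀ refl ∷ climb-path _ i≤t

exit-edge : ∀ p {l} → Edge (suc l) p (A l) (exit p (suc l))
exit-edge odd  = AZ₀ refl
exit-edge even = AQ refl refl

descend-path : ∀ {p t l x z ys} d j → d + j ≡ l → l < t → Edge t p (A l) x → Path (Edge t p) x z ys →
               Path (Edge t p) (A j) z (A j ∷ descend (suc j) d ++ ys)
descend-path zero    j refl l<t e p = e ∷ p
descend-path (suc d) j refl l<t e p = AZ j+1<t ∷ ZC j+1<t ∷ CB j+1<t ∷ BA j+1<t ∷
  descend-path d (suc j) (+-suc d j) l<t e p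
  where j+1<t = ≤-<-trans (s≤s (m≤n+m j d)) l<t

-- Visiting every vertex once is expressed as a permutation of one complete reference list, so that
-- a commutative monoid solver can check it.
record Itinerary (p : Parity) (t : ℕ) (s e : Vertex) : Set where
  constructor itinerary
  field
    {stops} : List Vertex
    path    : Path (Edge t p) s e stops
    perm    : stops ↭ bridge p t ++ climb t

-- Down block `i`, through the `d` blocks above it, over the bridge to `Z 0`, and up to `Z i`.
itinerary-ZZ : ∀ {p} d i → Itinerary p (d + suc i) (Z (suc i)) (Z i)
itinerary-ZZ {p} d i rewrite +-suc d i = itinerary
  (ZC i<t ∷ CB i<t ∷ BA i<t ∷ descend-path d i refl ≤-refl (exit-edge p) (bridge-path p (<⇒≤ i<t)))
  (↭-trans
    (solve 3 (λ r b k → r ⊕ (b ⊕ k) ⊜ b ⊕ (k ⊕ r)) refl (descend i (suc d)) (bridge p (suc (d + i))) (climb i))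
    (↭.++⁺ˡ (bridge p (suc (d + i))) (climb-descend (suc d) i)))
  where
  i<t : i < suc (d + i)
  i<t = s≤s (m≤n+m i d)

-- From `B i` up to `A (suc i)`, through the blocks above, over the bridge to `Z 0` and up to `A i`.
-- The edge from there to `Z (suc (suc i))` reaches the three vertices left out so far, down to
-- `B (suc i)`.
itinerary-BB : ∀ {p} d i → Itinerary p (d + suc (suc i)) (B i) (B (suc i))
itinerary-BB {p} d i rewrite +-suc d (suc i) = itinerary
  (BC i<t ∷ CZ i<t ∷ ZA si<t ∷ descend-path d (suc i) refl ≤-refl (exit-edge p)
    (join (bridge-path p (<⇒≤ i<t)) (ZA i<t) (AZ si<t ∷ ZC si<t ∷ CB si<t ∷ [ _ ])))
  (↭-trans
    (solve 11 (λ Bi Ci Z₁ A₁ r b k Ai Z₂ C₁ B₁ →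
        Bi ⊕ (Ci ⊕ (Z₁ ⊕ (A₁ ⊕ (r ⊕ ((b ⊕ k) ⊕ (Ai ⊕ (Z₂ ⊕ (C₁ ⊕ B₁)))))))) ⊜
        b ⊕ (((k ⊕ (Ai ⊕ (Bi ⊕ (Ci ⊕ Z₁)))) ⊕ (A₁ ⊕ (B₁ ⊕ (C₁ ⊕ Z₂)))) ⊕ r)) refl
      (B i ∷ []) (C i ∷ []) (Z (suc i) ∷ []) (A (suc i) ∷ []) (descend (suc (suc i)) d)
      (bridge p (suc (d + suc i))) (climb i) (A i ∷ []) (Z (suc (suc i)) ∷ []) (C (suc i) ∷ []) (B (suc i) ∷ []))
    (↭.++⁺ˡ (bridge p (suc (d + suc i)))
      (subst (λ m → climb (suc (suc i)) ++ descend (suc (suc i)) d ↭ climb m) (+-suc d (suc i))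
        (climb-descend d (suc (suc i))))))
  where
  si<t : suc i < suc (d + suc i)
  si<t = s≤s (m≤n+m (suc i) d)
  i<t : i < suc (d + suc i)
  i<t = <⇒≤ si<t

-- `A (suc u)` is used at once to reach `Z 0`, so the blockwise run ends at `A u` and jumps to the
-- last `Z`. The long edge from `C (suc u)` to `Z 1` then leads back to block 0.
itinerary-BB₀ : ∀ u → Itinerary odd (suc (suc u)) (B (suc u)) (B 0)
itinerary-BB₀ u = itinerary
  (BA ≤-refl ∷ AZ₀ refl ∷ ZA (s≤s z≤n) ∷ descend-path u 0 (+-comm u 0) (s≤s (m≤n+m u 1)) (AZ ≤-refl)
    (ZC ≤-refl ∷ CZ₁ refl ∷ ZC (s≤s z≤n) ∷ CB (s≤s z≤n) ∷ [ _ ]))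
  (↭-trans
    (solve 10 (λ Bu Au Z₀ A₀ r Zt Cu Z₁ C₀ B₀ →
        Bu ⊕ (Au ⊕ (Z₀ ⊕ (A₀ ⊕ (r ⊕ (Zt ⊕ (Cu ⊕ (Z₁ ⊕ (C₀ ⊕ B₀)))))))) ⊜
        ((Z₀ ⊕ (A₀ ⊕ (B₀ ⊕ (C₀ ⊕ Z₁)))) ⊕ r) ⊕ (Au ⊕ (Bu ⊕ (Cu ⊕ Zt)))) refl
      (B (suc u) ∷ []) (A (suc u) ∷ []) (Z 0 ∷ []) (A 0 ∷ []) (descend 1 u)
      (Z (suc (suc u)) ∷ []) (C (suc u) ∷ []) (Z 1 ∷ []) (C 0 ∷ []) (B 0 ∷ []))
    (↭.++⁺ʳ (A (suc u) ∷ B (suc u) ∷ C (suc u) ∷ Z (suc (suc u)) ∷ [])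
      (subst (λ m → climb 1 ++ descend 1 u ↭ climb m) (+-comm u 1) (climb-descend u 1))))

-- `Z 1`, `C 0` and `B 0` are kept for the end and reached from P.
itinerary-Z₀B : ∀ u → Itinerary even (suc u) (Z 0) (B 0)
itinerary-Z₀B u = itinerary
  (ZA (s≤s z≤n) ∷ descend-path u 0 (+-comm u 0) ≤-refl (AQ refl refl)
    (QP refl ∷ PZ₁ refl ∷ ZC (s≤s z≤n) ∷ CB (s≤s z≤n) ∷ [ _ ]))
  (↭-trans
    (solve 7 (λ ZA₀ r Q P Z₁ C₀ B₀ →
        ZA₀ ⊕ (r ⊕ (Q ⊕ (P ⊕ (Z₁ ⊕ (C₀ ⊕ B₀))))) ⊜
        (Q ⊕ P) ⊕ ((ZA₀ ⊕ (B₀ ⊕ (C₀ ⊕ Z₁))) ⊕ r)) refl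
      (Z 0 ∷ A 0 ∷ []) (descend 1 u) (B (suc u) ∷ []) (A (suc u) ∷ []) (Z 1 ∷ []) (C 0 ∷ []) (B 0 ∷ []))
    (↭.++⁺ˡ (bridge even (suc u))
      (subst (λ m → climb 1 ++ descend 1 u ↭ climb m) (+-comm u 1) (climb-descend u 1))))

-- P is taken early, as the way from the last `Z` to `Z 0`, and Q late, directly from `A i`.
itinerary-BQ : ∀ i → Itinerary even (suc i) (B i) (B (suc i))
itinerary-BQ i = itinerary
  (BC ≤-refl ∷ CZ ≤-refl ∷ ZP refl ∷ PZ₀ refl ∷
    join (climb-path i (<⇒≤ ≤-refl)) (ZA ≤-refl) (AQ refl refl ∷ [ _ ]))
  (solve 7 (λ Bi Ci Zt P k Ai Q →
      Bi ⊕ (Ci ⊕ (Zt ⊕ (P ⊕ (k ⊕ (Ai ⊕ Q))))) ⊜ (Q ⊕ P) ⊕ (k ⊕ (Ai ⊕ (Bi ⊕ (Ci ⊕ Zt))))) refl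
    (B i ∷ []) (C i ∷ []) (Z (suc i) ∷ []) (A (suc i) ∷ []) (climb i) (A i ∷ []) (B (suc i) ∷ []))

partner-itinerary : ∀ {p t s e} → Large p t → Partner t p s e → Itinerary p t s e
partner-itinerary {t = t} _ (ZZ {i = i} i<t) =
  subst (λ t → Itinerary _ t _ _) (m∸n+n≡m i<t) (itinerary-ZZ (t ∸ suc i) i)
partner-itinerary {t = t} _ (BB {i = i} lt) =
  subst (λ t → Itinerary _ t _ _) (m∸n+n≡m lt) (itinerary-BB (t ∸ suc (suc i)) i)
partner-itinerary _ (Z₀Z refl) = itinerary (climb-path _ ≤-refl) ↭-refl
partner-itinerary (s≤s (s≤s _)) (BB₀ refl) = itinerary-BB₀ _
partner-itinerary (s≤s _) Z₀B = itinerary-Z₀B _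
partner-itinerary _ (BQ refl) = itinerary-BQ _
partner-itinerary _ (QZ refl) = itinerary (bridge-path even ≤-refl) ↭-refl

upTo-++-∷ : ∀ m xs → upTo m ++ m ∷ xs ≡ upTo (suc m) ++ xs
upTo-++-∷ m xs = trans (sym (++-assoc (upTo m) (m ∷ []) xs)) (cong (_++ xs) (upTo-∷ʳ m))

map-pos-climb : ∀ i → map pos (climb i) ≡ upTo (1 + i * 4)
map-pos-climb zero = refl
map-pos-climb (suc i) = begin
  map pos (climb (suc i))                                ≡⟨ map-++ pos (climb i) _ ⟩
  map pos (climb i) ++ m ∷ 1 + m ∷ 2 + m ∷ 3 + m ∷ []    ≡⟨ cong (_++ (m ∷ 1 + m ∷ 2 + m ∷ 3 + m ∷ [])) (map-pos-climb i) ⟩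
  upTo m ++ m ∷ 1 + m ∷ 2 + m ∷ 3 + m ∷ []               ≡⟨ upTo-++-∷ m _ ⟩
  upTo (1 + m) ++ 1 + m ∷ 2 + m ∷ 3 + m ∷ []             ≡⟨ upTo-++-∷ (1 + m) _ ⟩
  upTo (2 + m) ++ 2 + m ∷ 3 + m ∷ []                     ≡⟨ upTo-++-∷ (2 + m) _ ⟩
  upTo (3 + m) ++ 3 + m ∷ []                             ≡⟨ upTo-∷ʳ (3 + m) ⟩
  upTo (4 + m)                                           ∎
  where
  open ≡-Reasoning
  m = 1 + i * 4

map-pos-all : ∀ p t → map pos (bridge p t ++ climb t) ↭ upTo (size p t)
map-pos-all odd  t = ↭-reflexive (map-pos-climb t)
map-pos-all even t = begin
  1 + m ∷ m ∷ map pos (climb t)    ≡⟨ cong (λ xs → 1 + m ∷ m ∷ xs) (map-pos-climb t) ⟩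
  -- The bridge lists Q before P, against the order of positions.
  1 + m ∷ m ∷ upTo m               ↭⟨ swap _ _ refl ⟩
  m ∷ 1 + m ∷ upTo m               ↭⟨ ↭.++-comm (m ∷ 1 + m ∷ []) (upTo m) ⟩
  upTo m ++ m ∷ 1 + m ∷ []         ≡⟨ upTo-++-∷ m _ ⟩
  upTo (1 + m) ++ 1 + m ∷ []       ≡⟨ upTo-∷ʳ (1 + m) ⟩
  upTo (2 + m)                     ∎
  where
  open PermutationReasoning
  m = 1 + t * 4

-- Translation between walks in the graph and paths of blocks

at-injective : ∀ {m n} → at m ≡ at n → m ≡ n
at-injective {m} {n} eq = trans (sym (pos-at m)) (trans (cong pos eq) (pos-at n))

module Transfer {n p t} {adj : Adj n} (n≡ : n ≡ size p t)
                (adj⇔Edge : ∀ u v → adj u v ≡ true ⇔ Edge t p (at (toℕ u)) (at (toℕ v))) where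

  vertex : Fin n → Vertex
  vertex = at ∘ toℕ

  walk⇒path : ∀ {u w} (q : Walk adj u w) → Path (Edge t p) (vertex u) (vertex w) (map vertex (vertices q))
  walk⇒path [ v ]        = [ _ ]
  walk⇒path (u ∷⟨ e ⟩ q) = Equivalence.to (adj⇔Edge _ _) e ∷ walk⇒path q

  hamPath⇒tour : ∀ {u w} → HamPath adj u w → Tour p t (vertex u) (vertex w)
  hamPath⇒tour (q , uniq , cov) = record
    { path   = walk⇒path q
    ; unique = Unique.map⁺ (toℕ-injective ∘ at-injective) uniq
    ; cover  = λ v v< → subst (_∈ map vertex (vertices q))
        (trans (cong at (toℕ-fromℕ< (subst (pos v <_) (sym n≡) v<))) (at-pos v))
        (∈-map⁺ vertex (cov (fromℕ< (subst (pos v <_) (sym n≡) v<))))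
    }

  -- The inner vertices are rebuilt from their positions by `fromℕ<` and the ends are known by
  -- position only, so the two vertex lists are compared as lists of numbers.
  path⇒walk : ∀ {s e xs} → Path (Edge t p) s e xs → All (λ v → pos v < n) xs →
              ∀ {u w} → toℕ u ≡ pos s → toℕ w ≡ pos e →
              Σ (Walk adj u w) λ q → map toℕ (vertices q) ≡ map pos xs
  path⇒walk [ x ] _ {u} u≡ w≡ with refl ← toℕ-injective (trans u≡ (sym w≡)) = [ u ] , cong (_∷ []) u≡
  path⇒walk {s} (_∷_ {y = y} e q) (_ ∷ bounds) {u} u≡ w≡ = u ∷⟨ e′ ⟩ proj₁ rest , cong₂ _∷_ u≡ (proj₂ rest)
    where
    y< = All.lookup bounds (start-∈ q)
    rest = path⇒walk q bounds (toℕ-fromℕ< y<) w≡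
    e′ : adj u (fromℕ< y<) ≡ true
    e′ = Equivalence.from (adj⇔Edge u _) (subst₂ (Edge t p)
      (sym (trans (cong at u≡) (at-pos s))) (sym (trans (cong at (toℕ-fromℕ< y<)) (at-pos y))) e)

  itinerary⇒hamPath : ∀ {s e} → Itinerary p t s e → ∀ {u w} → toℕ u ≡ pos s → toℕ w ≡ pos e → HamPath adj u w
  itinerary⇒hamPath (itinerary {xs} path perm) u≡ w≡ =
    q , Unique.map⁻ (subst Unique (sym eq) uniq) , λ v →
      let (_ , w∈ , v≡w) = ∈-map⁻ toℕ (subst (toℕ v ∈_) (sym eq) (↭.∈-resp-↭ (↭-sym positions) (∈-upTo⁺ (toℕ<n v))))
      in subst (_∈ vertices q) (sym (toℕ-injective v≡w)) w∈
    where
    positions : map pos xs ↭ upTo n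
    positions = ↭-trans (↭.map⁺ pos perm) (subst (λ m → _ ↭ upTo m) (sym n≡) (map-pos-all p t))
    uniq : Unique (map pos xs)
    uniq = ↭ₛ.Unique-resp-↭ (setoid ℕ) (↭⇒↭ₛ (↭-sym positions)) (Unique.upTo⁺ n)
    walk = path⇒walk path (All.tabulate λ v∈ → ∈-upTo⁻ (↭.∈-resp-↭ positions (∈-map⁺ pos v∈))) u≡ w≡
    q = proj₁ walk
    eq = proj₂ walk

-- The definition of S_k in terms of blocks

if-true : ∀ {A : Set} {b} {x y : A} → b ≡ true → (if b then x else y) ≡ x
if-true refl = refl

if-false : ∀ {A : Set} {b} {x y : A} → b ≡ false → (if b then x else y) ≡ y
if-false refl = refl

order : Parity → ℕ → ℕ
order odd  t = 1 + t * 2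
order even t = 2 + t * 2

split-order : ∀ k → ∃₂ λ p t → suc k ≡ order p t
split-order 0 = odd , 0 , refl
split-order 1 = even , 0 , refl
split-order (suc (suc k)) with split-order k
... | odd  , t , eq = odd  , suc t , cong (2 +_) eq
... | even , t , eq = even , suc t , cong (2 +_) eq

order-large : ∀ p t → 4 ≤ order p t → Large p t
order-large odd  0 (s≤s ())
order-large odd  1 (s≤s (s≤s (s≤s ())))
order-large odd  (suc (suc t)) _ = s≤s (s≤s z≤n)
order-large even 0 (s≤s (s≤s ()))
order-large even (suc t) _ = s≤s z≤n

2*[c+i*2] : ∀ c i → 2 * (c + i * 2) ≡ 2 * c + i * 4
2*[c+i*2] c i = begin
  2 * (c + i * 2)       ≡⟨ *-distribˡ-+ 2 c (i * 2) ⟩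
  2 * c + 2 * (i * 2)   ≡⟨ cong (2 * c +_) (*-comm 2 (i * 2)) ⟩
  2 * c + i * 2 * 2     ≡⟨ cong (2 * c +_) (*-assoc i 2 2) ⟩
  2 * c + i * 4         ∎
  where open ≡-Reasoning

isEven-double : ∀ i → isEven (i * 2) ≡ true
isEven-double zero    = refl
isEven-double (suc i) = isEven-double i

isEven-double+1 : ∀ i → isEven (1 + i * 2) ≡ false
isEven-double+1 zero    = refl
isEven-double+1 (suc i) = isEven-double+1 i

lab : Vertex → ℕ
lab v = suc (pos v)

labels : Vertex → Vertex → ℕ × ℕ
labels x y = lab x , lab y

-- Once `4 * suc i` is replaced by `suc i * 4`, which unfolds to `4 + i * 4`, the truncated
-- subtractions evaluate. `block` gathers the occurrences so that one `cong` replaces them all.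
undEdges-labels : ∀ i → undEdges (suc i) ≡
  labels (A i) (B i) ∷ labels (B i) (A i) ∷ labels (B i) (C i) ∷ labels (C i) (B i) ∷
  labels (C i) (Z (suc i)) ∷ labels (Z (suc i)) (C i) ∷ []
undEdges-labels i = trans (cong (λ q → block q (q + 1)) (*-comm 4 (suc i)))
                          (cong (block (4 + i * 4)) (+-comm (4 + i * 4) 1))
  where
  block : ℕ → ℕ → List (ℕ × ℕ)
  block q r = undirected (q ∸ 2) (q ∸ 1) ++ undirected (q ∸ 1) q ++ undirected q r

dirEdges-labels : ∀ i → dirEdges (suc i) ≡
  labels (A i) (Z (suc (suc i))) ∷ labels (Z (suc i)) (A (suc i)) ∷ []
dirEdges-labels i = trans (cong (λ q → block q (q + 5) (q + 1) (q + 2)) (*-comm 4 (suc i)))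
  (trans (cong (λ r → block q r (q + 1) (q + 2)) (+-comm q 5))
         (cong₂ (block q (5 + q)) (+-comm q 1) (+-comm q 2)))
  where
  q = 4 + i * 4
  block : ℕ → ℕ → ℕ → ℕ → List (ℕ × ℕ)
  block q r₅ r₁ r₂ = (q ∸ 2 , r₅) ∷ (r₁ , r₂) ∷ []

extraEdges : Parity → ℕ → List (ℕ × ℕ)
extraEdges odd  u = labels (Z 0) (A 0) ∷ labels (A u) (Z 0) ∷ labels (C u) (Z 1) ∷ []
extraEdges even u = labels (Z 0) (A 0) ∷ labels (A u) (B (suc u)) ∷ labels (Z (suc u)) (A (suc u)) ∷
  labels (A (suc u)) (Z 0) ∷ labels (A (suc u)) (Z 1) ∷ labels (B (suc u)) (A (suc u)) ∷ []

edgeList : Parity → ℕ → List (ℕ × ℕ)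
edgeList p u = concatMap undEdges (range (suc u)) ++ concatMap dirEdges (range u) ++ extraEdges p u

-- `edges` abstracts the two quotients and 2k; with `t` written as `suc u`, 2k becomes a numeral
-- plus `u * 4` and the subtractions evaluate.
SkEdges-labels : ∀ p u → SkEdges (order p (suc u)) ≡ edgeList p u
SkEdges-labels odd u = trans (if-false (isEven-double+1 u))
  (trans (cong (edges (suc u * 2 / 2) (u * 2 / 2)) (2*[c+i*2] 3 u)) (cong₂ (λ a b → edges a b (6 + u * 4)) (m*n/n≡m (suc u) 2) (m*n/n≡m u 2)))
  where
  edges : ℕ → ℕ → ℕ → List (ℕ × ℕ)
  edges a b q = concatMap undEdges (range a) ++ concatMap dirEdges (range b)
    ++ (1 , 2) ∷ (q ∸ 4 , 1) ∷ (q ∸ 2 , 5) ∷ []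
SkEdges-labels even u = trans (if-true (isEven-double u))
  (trans (cong (edges (suc u * 2 / 2) (u * 2 / 2)) (2*[c+i*2] 4 u)) (cong₂ (λ a b → edges a b (8 + u * 4)) (m*n/n≡m (suc u) 2) (m*n/n≡m u 2)))
  where
  edges : ℕ → ℕ → ℕ → List (ℕ × ℕ)
  edges a b q = concatMap undEdges (range a) ++ concatMap dirEdges (range b)
    ++ (1 , 2) ∷ (q ∸ 6 , q ∸ 1) ∷ (q ∸ 3 , q ∸ 2) ∷ (q ∸ 2 , 1) ∷ (q ∸ 2 , 5) ∷ (q ∸ 1 , q ∸ 2) ∷ []

IsEdge : Parity → ℕ → ℕ × ℕ → Set
IsEdge p t ab = ∃₂ λ x y → Edge t p x y × ab ≡ labels x y

All-concatMap-range : ∀ {P : ℕ × ℕ → Set} f r → (∀ {i} → i < r → All P (f (suc i))) → All P (concatMap f (range r))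
All-concatMap-range f r h = All.concat⁺ (All.map⁺ (All.map⁺ (All.applyUpTo⁺₁ id r h)))

SkEdges-sound : ∀ p u → All (IsEdge p (suc u)) (SkEdges (order p (suc u)))
SkEdges-sound p u = subst (All (IsEdge p (suc u))) (sym (SkEdges-labels p u))
  (All.++⁺ (All-concatMap-range undEdges (suc u) λ {i} i<t → subst (All _) (sym (undEdges-labels i))
      (edge′ (AB i<t) ∷ edge′ (BA i<t) ∷ edge′ (BC i<t) ∷ edge′ (CB i<t) ∷ edge′ (CZ i<t) ∷ edge′ (ZC i<t) ∷ []))
  (All.++⁺ (All-concatMap-range dirEdges u λ {i} i<u → subst (All _) (sym (dirEdges-labels i))
      (edge′ (AZ (s≤s i<u)) ∷ edge′ (ZA (s≤s i<u)) ∷ []))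
    (extra p)))
  where
  edge′ : ∀ {p t x y} → Edge t p x y → IsEdge p t (labels x y)
  edge′ e = _ , _ , e , refl
  extra : ∀ p → All (IsEdge p (suc u)) (extraEdges p u)
  extra odd  = edge′ (ZA (s≤s z≤n)) ∷ edge′ (AZ₀ refl) ∷ edge′ (CZ₁ refl) ∷ []
  extra even = edge′ (ZA (s≤s z≤n)) ∷ edge′ (AQ refl refl) ∷ edge′ (ZP refl) ∷
               edge′ (PZ₀ refl) ∷ edge′ (PZ₁ refl) ∷ edge′ (QP refl) ∷ []

in-range : ∀ f {r i} {xy : ℕ × ℕ} → i < r → xy ∈ f (suc i) → xy ∈ concatMap f (range r)
in-range f i<r xy∈ = ∈-concatMap⁺ f (lose (∈-map⁺ suc (∈-upTo⁺ i<r)) xy∈)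

edgeList-complete : ∀ {p u x y} → Edge (suc u) p x y → labels x y ∈ edgeList p u
edgeList-complete {u = u} = λ where
    (AB i<t) → und i<t (here refl)
    (BA i<t) → und i<t (there (here refl))
    (BC i<t) → und i<t (there (there (here refl)))
    (CB i<t) → und i<t (there (there (there (here refl))))
    (CZ i<t) → und i<t (there (there (there (there (here refl)))))
    (ZC i<t) → und i<t (there (there (there (there (there (here refl))))))
    (AZ (s≤s i<u)) → dir i<u (here refl)
    -- The edge from `Z` to `A` of a block is listed with the index of the block before it; in block
    -- 0 it is the separate edge (1, 2).
    (ZA {i = suc i} (s≤s i<u)) → dir i<u (there (here refl))
    (ZA {odd}  {zero} _) → extra odd (here refl)
    (ZA {even} {zero} _) → extra even (here refl)
    (AZ₀ refl)     → extra odd (there (here refl))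
    (CZ₁ refl)     → extra odd (there (there (here refl)))
    (AQ refl refl) → extra even (there (here refl))
    (ZP refl)      → extra even (there (there (here refl)))
    (PZ₀ refl)     → extra even (there (there (there (here refl))))
    (PZ₁ refl)     → extra even (there (there (there (there (here refl)))))
    (QP refl)      → extra even (there (there (there (there (there (here refl))))))
  where
  und : ∀ {p i xy} → i < suc u → xy ∈ _ → xy ∈ edgeList p u
  und {i = i} {xy} i<t xy∈ = ∈-++⁺ˡ (in-range undEdges i<t (subst (xy ∈_) (sym (undEdges-labels i)) xy∈))
  dir : ∀ {p i xy} → i < u → xy ∈ _ → xy ∈ edgeList p u
  dir {i = i} {xy} i<u xy∈ = ∈-++⁺ʳ (concatMap undEdges (range (suc u)))
    (∈-++⁺ˡ (in-range dirEdges i<u (subst (xy ∈_) (sym (dirEdges-labels i)) xy∈)))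
  extra : ∀ p {xy} → xy ∈ extraEdges p u → xy ∈ edgeList p u
  extra _ xy∈ = ∈-++⁺ʳ (concatMap undEdges (range (suc u))) (∈-++⁺ʳ (concatMap dirEdges (range u)) xy∈)

SkEdges-complete : ∀ {p u x y} → Edge (suc u) p x y → labels x y ∈ SkEdges (order p (suc u))
SkEdges-complete {p} {u} {x} {y} e = subst (labels x y ∈_) (sym (SkEdges-labels p u)) (edgeList-complete e)

at-lab : ∀ {n v} → suc n ≡ lab v → at n ≡ v
at-lab {v = v} eq = trans (cong at (suc-injective eq)) (at-pos v)

SkAdj⇔Edge : ∀ p u (x y : Fin (Sk-size (order p (suc u)))) →
             SkAdj (order p (suc u)) x y ≡ true ⇔ Edge (suc u) p (at (toℕ x)) (at (toℕ y))
SkAdj⇔Edge p u x y = mk⇔ to from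
  where
  k = order p (suc u)
  to : SkAdj k x y ≡ true → Edge (suc u) p (at (toℕ x)) (at (toℕ y))
  to eq with find (Any.any⁻ _ (SkEdges k) (Equivalence.from T-≡ eq))
  ... | (a , b) , ab∈ , ab≡ with Equivalence.to (T-∧ {a ≡ᵇ label x} {b ≡ᵇ label y}) ab≡ | All.lookup (SkEdges-sound p u) ab∈
  ... | a≡ , b≡ | _ , _ , e , refl = subst₂ (Edge (suc u) p)
          (sym (at-lab (sym (≡ᵇ⇒≡ a (label x) a≡)))) (sym (at-lab (sym (≡ᵇ⇒≡ b (label y) b≡)))) e
  from : Edge (suc u) p (at (toℕ x)) (at (toℕ y)) → SkAdj k x y ≡ true
  from e = Equivalence.to T-≡ (Any.any⁺ _ (lose (SkEdges-complete e)
    (Equivalence.from (T-∧ {lab (at (toℕ x)) ≡ᵇ label x} {lab (at (toℕ y)) ≡ᵇ label y}) (≡⇒≡ᵇ _ (label x) (cong suc (pos-at (toℕ x))) , ≡⇒≡ᵇ _ (label y) (cong suc (pos-at (toℕ y)))))))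

-- Positions of the incoming and outgoing vertices

clamp-toℕ : ∀ N i → i ≤ N → toℕ (clamp N i) ≡ i
clamp-toℕ zero    zero    _         = refl
clamp-toℕ (suc N) zero    _         = refl
clamp-toℕ (suc N) (suc i) (s≤s i≤N) = cong suc (clamp-toℕ N i i≤N)

Sk-size-order : ∀ p t → Sk-size (order p t) ≡ size p t
Sk-size-order odd  t = cong (λ m → suc (m ∸ 2)) (2*[c+i*2] 1 t)
Sk-size-order even t = cong (λ m → suc (m ∸ 2)) (2*[c+i*2] 2 t)


suc-Sk-size : ∀ {k} → 0 < k → suc (Sk-size k) ≡ 2 * k
suc-Sk-size 0<k = m+[n∸m]≡n (*-monoʳ-≤ 2 0<k)

order-positive : ∀ p t → 0 < order p t
order-positive odd  _ = s≤s z≤n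
order-positive even _ = s≤s z≤n

SkIn-toℕ : ∀ k (j : Fin k) → toℕ (SkIn k j) ≡ 2 * toℕ j
SkIn-toℕ (suc k) j = trans (cong (λ m → toℕ (clamp (2 * suc k ∸ 2) (m ∸ 1 ∸ 1))) (*-suc 2 (toℕ j)))
  (clamp-toℕ _ _ (subst (λ m → 2 * toℕ j ≤ m ∸ 2) (sym (*-suc 2 k)) (*-monoʳ-≤ 2 (s≤s⁻¹ (toℕ<n j)))))

SkIn-injective : ∀ k → Injective _≡_ _≡_ (SkIn k)
SkIn-injective k {i} {j} eq = toℕ-injective (*-cancelˡ-≡ _ _ 2
  (trans (sym (SkIn-toℕ k i)) (trans (cong toℕ eq) (SkIn-toℕ k j))))

SkOut-toℕ : ∀ k (m : Fin k) {e} → SkOutLabel k (label m) ≡ lab e → pos e < Sk-size k → toℕ (SkOut k m) ≡ pos e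
SkOut-toℕ k m {e} eq (s≤s e≤) =
  trans (cong (λ l → toℕ (vtx k l)) eq) (clamp-toℕ _ (pos e) e≤)

double≢double+1 : ∀ i j → i * 2 ≢ 1 + j * 2
double≢double+1 zero    j       ()
double≢double+1 (suc i) (suc j) eq = double≢double+1 i j (suc-injective (suc-injective eq))

≡ᵇ-true : ∀ {m n} → m ≡ n → (m ≡ᵇ n) ≡ true
≡ᵇ-true {m} {n} eq = Equivalence.to T-≡ (≡⇒≡ᵇ m n eq)

≡ᵇ-false : ∀ {m n} → m ≢ n → (m ≡ᵇ n) ≡ false
≡ᵇ-false {m} {n} neq = ¬-not λ eq → neq (≡ᵇ⇒≡ m n (Equivalence.from T-≡ eq))

data Half : ℕ → Set where
  double   : ∀ i → Half (i * 2)
  double+1 : ∀ i → Half (1 + i * 2)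

half : ∀ m → Half m
half 0 = double 0
half 1 = double+1 0
half (suc (suc m)) with half m
... | double i   = double (suc i)
... | double+1 i = double+1 (suc i)

-- `m` counts from 0, so the incoming vertex has position 2m, while the formula for the outgoing
-- label takes `suc m`.
record Matched (p : Parity) (t m : ℕ) : Set where
  constructor matched
  field
    {start end} : Vertex
    partner : Partner t p start end
    in≡     : 2 * m ≡ pos start
    out≡    : SkOutLabel (order p t) (suc m) ≡ lab end

double-<⁻ : ∀ i t → 1 + i * 2 ≤ t * 2 → i < t
double-<⁻ i t lt = *-cancelʳ-< 2 i t lt

2*[i*2] : ∀ i → 2 * (i * 2) ≡ i * 4
2*[i*2] = 2*[c+i*2] 0

generic-double : ∀ i → 2 * (2 + i * 2) + 3 ≡ 7 + i * 4
generic-double i = trans (cong (_+ 3) (2*[c+i*2] 2 i)) (+-comm (4 + i * 4) 3)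

-- Even `m` belongs to a `Z`, odd `m` to a `B`. The chains of `if-true` and `if-false` pass through
-- the nested tests of `SkOutLabel`, each decided by parity or by comparing halves.
match : ∀ p t m → m < order p t → Matched p t m
match odd t m m< with half m
... | double zero = matched (Z₀Z refl) refl (trans (if-false (isEven-double+1 t)) (cong (_∸ 1) (2*[c+i*2] 1 t)))
... | double (suc i) = matched (ZZ i<t) (2*[i*2] (suc i))
  (trans (if-false (isEven-double+1 t)) (trans (if-false (≡ᵇ-false {3 + i * 2} {t * 2} (double≢double+1 t (suc i) ∘ sym)))
    last))
  where
  i<t : i < t
  i<t = double-<⁻ i t (≤-trans (m≤n+m _ 1) (s≤s⁻¹ m<))
  -- The special entry 2k - 5 agrees with the generic formula at index k, so both cases give the
  -- label of `Z i`.
  last : _ ≡ 1 + i * 4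
  last with suc i ≟ t
  ... | yes refl = trans (if-true (≡ᵇ-true {i * 2} refl)) (cong (_∸ 5) (2*[c+i*2] 3 i))
  ... | no neq   = trans (if-false (≡ᵇ-false {3 + i * 2} {1 + t * 2} λ eq → neq (*-cancelʳ-≡ (suc i) t 2 (suc-injective eq))))
                         (trans (if-false (isEven-double+1 i)) (cong (_∸ 5) (2*[c+i*2] 3 i)))
match odd t m m< | double+1 i with suc i ≟ t
... | yes refl = matched (BB₀ refl) (2*[c+i*2] 1 i)
  (trans (if-false (isEven-double+1 i)) (if-true (≡ᵇ-true {i * 2} refl)))
... | no neq = matched (BB (≤∧≢⇒< (double-<⁻ i t (s≤s⁻¹ m<)) neq)) (2*[c+i*2] 1 i)
  (trans (if-false (isEven-double+1 t))
  (trans (if-false (≡ᵇ-false {2 + i * 2} {t * 2} λ eq → neq (*-cancelʳ-≡ (suc i) t 2 eq)))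
  (trans (if-false (≡ᵇ-false {2 + i * 2} {1 + t * 2} (double≢double+1 (suc i) t)))
  (trans (if-true (isEven-double i)) (generic-double i)))))
match even t m m< with half m
... | double zero = matched Z₀B refl (if-true (isEven-double t))
... | double (suc i) = matched (ZZ i<t) (2*[i*2] (suc i))
  (trans (if-true (isEven-double t)) (trans (if-false (≡ᵇ-false {3 + i * 2} {t * 2} (double≢double+1 t (suc i) ∘ sym)))
    last))
  where
  i<t : i < t
  i<t = double-<⁻ i t (s≤s⁻¹ (s≤s⁻¹ m<))
  last : _ ≡ 1 + i * 4
  last with suc i ≟ t
  ... | yes refl = trans (if-true (≡ᵇ-true {i * 2} refl)) (cong (_∸ 7) (2*[c+i*2] 4 i))
  ... | no neq   = trans (if-false (≡ᵇ-false {3 + i * 2} {1 + t * 2} λ eq → neq (*-cancelʳ-≡ (suc i) t 2 (suc-injective eq))))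
                  (trans (if-false (≡ᵇ-false {3 + i * 2} {2 + t * 2} (double≢double+1 (suc t) (suc i) ∘ sym)))
                         (trans (if-false (isEven-double+1 i)) (cong (_∸ 5) (2*[c+i*2] 3 i))))
-- The index `2 + i * 2`, counted from 1, is k - 2 when `suc i ≡ t` and k when `i ≡ t`; it is never
-- the odd number k - 1.
match even t m m< | double+1 i with suc i ≟ t | i ≟ t
... | yes refl | _ = matched (BQ refl) (2*[c+i*2] 1 i)
  (trans (if-true (isEven-double i)) (trans (if-true (≡ᵇ-true {i * 2} refl)) (cong (_∸ 1) (2*[c+i*2] 4 i))))
... | no neq | yes refl = matched (QZ refl) (2*[c+i*2] 1 i)
  (trans (if-true (isEven-double i))
  (trans (if-false (≡ᵇ-false {2 + i * 2} {i * 2} λ eq → neq (*-cancelʳ-≡ (suc i) i 2 eq)))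
  (trans (if-false (≡ᵇ-false {2 + i * 2} {1 + i * 2} (double≢double+1 (suc i) i)))
  (trans (if-true (≡ᵇ-true {i * 2} refl)) (cong (_∸ 3) (2*[c+i*2] 2 i))))))
... | no neq | no neq′ = matched (BB (≤∧≢⇒< (≤∧≢⇒< i≤t neq′) neq)) (2*[c+i*2] 1 i)
  (trans (if-true (isEven-double t))
  (trans (if-false (≡ᵇ-false {2 + i * 2} {t * 2} λ eq → neq (*-cancelʳ-≡ (suc i) t 2 eq)))
  (trans (if-false (≡ᵇ-false {2 + i * 2} {1 + t * 2} (double≢double+1 (suc i) t)))
  (trans (if-false (≡ᵇ-false {2 + i * 2} {2 + t * 2} λ eq → neq′ (suc-injective (*-cancelʳ-≡ (suc i) (suc t) 2 eq))))
  (trans (if-true (isEven-double i)) (generic-double i))))))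
  where
  i≤t : i ≤ t
  i≤t = s≤s⁻¹ (double-<⁻ i (suc t) (≤-trans (m≤n+m _ 1) m<))

partner-bound : ∀ {p t s e} → Large p t → Partner t p s e → pos e < size p t
partner-bound {p} {t} _ (ZZ i<t) = ≤-trans (s≤s (offset 0 i<t)) (blocks-fit p t)
partner-bound {p} {t} _ (BB i<t) = ≤-trans (s≤s (offset 2 i<t)) (blocks-fit p t)
partner-bound _ (Z₀Z refl) = ≤-refl
partner-bound large (BB₀ _) = s≤s (offset 2 (<⇒≤ large))
partner-bound _ Z₀B = s≤s (s≤s (s≤s z≤n))
partner-bound _ (BQ refl) = ≤-refl
partner-bound {t = t} _ (QZ refl) = blocks-fit even t

-- The single visit condition

main : Vertex → Bool
main (Z _) = true
main (A _) = false
main (B _) = true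
main (C _) = false

edge-bipartite : ∀ {p t x y} → Edge t p x y → main x ≢ main y
edge-bipartite (ZA _)   ()
edge-bipartite (AB _)   ()
edge-bipartite (BA _)   ()
edge-bipartite (BC _)   ()
edge-bipartite (CB _)   ()
edge-bipartite (CZ _)   ()
edge-bipartite (ZC _)   ()
edge-bipartite (AZ _)   ()
edge-bipartite (AZ₀ _)  ()
edge-bipartite (CZ₁ _)  ()
edge-bipartite (ZP _)   ()
edge-bipartite (AQ _ _) ()
edge-bipartite (QP _)   ()
edge-bipartite (PZ₀ _)  ()
edge-bipartite (PZ₁ _)  ()

partner-main : ∀ {p t s e} → Partner t p s e → main s ≡ true × main e ≡ true
partner-main (ZZ _)  = refl , refl
partner-main (BB _)  = refl , refl
partner-main (Z₀Z _) = refl , refl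
partner-main (BB₀ _) = refl , refl
partner-main Z₀B     = refl , refl
partner-main (BQ _)  = refl , refl
partner-main (QZ _)  = refl , refl

main-pos : ∀ v → main v ≡ true → ∃ λ m → pos v ≡ 2 * m
main-pos (Z i) _ = i * 2 , sym (2*[c+i*2] 0 i)
main-pos (B i) _ = 1 + i * 2 , sym (2*[c+i*2] 1 i)

module Bipartite {k n} {adj : Adj n} {ins outs : Fin k → Fin n} (side : Fin n → Bool)
  (bipartite : ∀ u v → adj u v ≡ true → side u ≢ side v)
  (ins-side : ∀ j → side (ins j) ≡ true) (outs-side : ∀ j → side (outs j) ≡ true)
  (side-ins : ∀ v → side v ≡ true → ∃ λ j → v ≡ ins j) (2k≤1+n : 2 * k ≤ suc n) where

  onSide : List (Fin n) → List (Fin n)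
  onSide = filter (λ v → side v ≟ᵇ true)

  -- A walk changes sides at every step, so one that ends on the side `true` has one vertex more
  -- there than elsewhere if it also starts there, and equally many otherwise. Doubling avoids
  -- subtraction.
  alternation : ∀ {u w} (p : Walk adj u w) → side w ≡ true →
    2 * length (onSide (vertices p)) ≡ (if side u then 1 else 0) + length (vertices p)
  alternation [ v ] w≡ rewrite w≡ = refl
  alternation (_∷⟨_⟩_ u {v} e p) w≡ with alternation p w≡
  ... | ih with side u in u≡ | side v in v≡
  ... | true  | true  = contradiction (trans u≡ (sym v≡)) (bipartite u v e)
  ... | false | false = contradiction (trans u≡ (sym v≡)) (bipartite u v e)
  ... | true  | false = trans (*-suc 2 _) (cong (2 +_) ih)
  ... | false | true  = ih

  -- Each path begins and ends on the side `true`, hence contributes an excess of exactly one.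
  totals : ∀ (ps : List (IOPath adj ins outs)) →
    2 * length (onSide (concatMap ioVertices ps)) ≡ length ps + length (concatMap ioVertices ps)
  totals [] = refl
  totals ((j , m , p) ∷ ps) = begin
    2 * length (onSide (xs ++ ys))                         ≡⟨ cong (λ zs → 2 * length zs) (filter-++ _ xs ys) ⟩
    2 * length (onSide xs ++ onSide ys)                    ≡⟨ cong (2 *_) (length-++ (onSide xs)) ⟩
    2 * (length (onSide xs) + length (onSide ys))          ≡⟨ *-distribˡ-+ 2 (length (onSide xs)) _ ⟩
    2 * length (onSide xs) + 2 * length (onSide ys)        ≡⟨ cong₂ _+_ (alternation p (outs-side m)) (totals ps) ⟩
    (if side (ins j) then 1 else 0) + length xs + (length ps + length ys)
      ≡⟨ cong (λ b → (if b then 1 else 0) + length xs + (length ps + length ys)) (ins-side j) ⟩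
    suc (length xs + (length ps + length ys))              ≡⟨ cong suc (x∙yz≈y∙xz +-commutativeSemigroup (length xs) (length ps) (length ys)) ⟩
    suc (length ps + (length xs + length ys))              ≡⟨ cong (λ m → suc (length ps + m)) (sym (length-++ xs)) ⟩
    suc (length ps + length (xs ++ ys))                    ∎
    where
    open ≡-Reasoning
    xs = vertices p
    ys = concatMap ioVertices ps

  single-visit : SingleVisit adj ins outs
  single-visit (ps , 2≤ps , simple , disjoint , cover) = n≮n (suc n) (begin
    2 + n                    ≤⟨ +-mono-≤ 2≤ps (covering⇒≤length covered) ⟩
    length ps + length all   ≡⟨ sym (totals ps) ⟩
    2 * length (onSide all)  ≤⟨ *-monoʳ-≤ 2 few ⟩
    2 * k                    ≤⟨ 2k≤1+n ⟩
    1 + n                    ∎)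
    where
    open ≤-Reasoning
    all = concatMap ioVertices ps
    covered : ∀ v → v ∈ all
    covered v = ∈-concatMap⁺ ioVertices (cover v)
    uniq : Unique all
    uniq = Unique.concat⁺ (All.map⁺ simple) (AllPairs.map⁺ disjoint)
    few : length (onSide all) ≤ k
    few = subst (length (onSide all) ≤_) (length-tabulate ins)
      -- Every vertex on the side `true` is incoming, so the list of the `k` incoming vertices
      -- contains them all.
      (unique-⊆⇒length≤ (Unique.filter⁺ _ uniq) λ v∈ →
        let (j , v≡) = side-ins _ (proj₂ (∈-filter⁻ _ {xs = all} v∈)) in
        subst (_∈ tabulate ins) (sym v≡) (∈-tabulate⁺ j))

-- Assembly of the conditions for S_k

Sk-inOut : ∀ p t → Large p t →
  IsInOut (order p t) (Sk-size (order p t)) (SkAdj (order p t)) (SkIn (order p t)) (SkOut (order p t))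
Sk-inOut p zero large = contradiction (large⇒0< {p} large) λ ()
Sk-inOut p t@(suc u) large = simple , SkIn-injective k , outs-injective , paired , single-visit
  where
  k = order p t
  n = Sk-size k
  n≡ : n ≡ size p t
  n≡ = Sk-size-order p t
  open Transfer {p = p} {t} {SkAdj k} n≡ (SkAdj⇔Edge p u)

  mate : ∀ m → Matched p t (toℕ m)
  mate m = match p t (toℕ m) (toℕ<n m)

  start end : Fin k → Vertex
  start m = Matched.start (mate m)
  end   m = Matched.end (mate m)

  partner : ∀ m → Partner t p (start m) (end m)
  partner m = Matched.partner (mate m)

  in-pos : ∀ m → toℕ (SkIn k m) ≡ pos (start m)
  in-pos m = trans (SkIn-toℕ k m) (Matched.in≡ (mate m))

  out-pos : ∀ m → toℕ (SkOut k m) ≡ pos (end m)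
  out-pos m = SkOut-toℕ k m {end m} (Matched.out≡ (mate m)) (subst (pos (end m) <_) (sym n≡) (partner-bound large (partner m)))

  in-vertex : ∀ m → vertex (SkIn k m) ≡ start m
  in-vertex m = trans (cong at (in-pos m)) (at-pos _)

  out-vertex : ∀ m → vertex (SkOut k m) ≡ end m
  out-vertex m = trans (cong at (out-pos m)) (at-pos _)

  ham : ∀ m → HamPath (SkAdj k) (SkIn k m) (SkOut k m)
  ham m = itinerary⇒hamPath (partner-itinerary large (partner m)) (in-pos m) (out-pos m)

  ham-unique : ∀ j m → HamPath (SkAdj k) (SkIn k j) (SkOut k m) → j ≡ m
  ham-unique j m h = SkIn-injective k (toℕ-injective (at-injective (trans
    (start-unique large (partner m) (subst (Tour p t _) (out-vertex m) (hamPath⇒tour h)))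
    (sym (in-vertex m)))))

  paired : PairedVertices (SkAdj k) (SkIn k) (SkOut k)
  paired j m = mk⇔ (ham-unique j m) λ { refl → ham j }

  -- If two outgoing vertices coincided, the Hamiltonian path of one index would also end at the
  -- outgoing vertex of the other, against `ham-unique`.
  outs-injective : Injective _≡_ _≡_ (SkOut k)
  outs-injective {i} {j} eq = ham-unique i j (subst (HamPath (SkAdj k) (SkIn k i)) eq (ham i))

  side : Fin n → Bool
  side v = main (vertex v)

  bipartite : ∀ u v → SkAdj k u v ≡ true → side u ≢ side v
  bipartite u v e = edge-bipartite (Equivalence.to (SkAdj⇔Edge p _ u v) e)

  simple : Simple (SkAdj k)
  simple v = ¬-not λ e → bipartite v v e refl

  1+n≡2*k : suc n ≡ 2 * k
  1+n≡2*k = suc-Sk-size (order-positive p t)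

  side-ins : ∀ v → side v ≡ true → ∃ λ j → v ≡ SkIn k j
  side-ins v v∈ with main-pos (vertex v) v∈
  ... | m , eq = fromℕ< m<k , toℕ-injective (trans v≡ (sym (trans (SkIn-toℕ k (fromℕ< m<k)) (cong (2 *_) (toℕ-fromℕ< m<k)))))
    where
    v≡ : toℕ v ≡ 2 * m
    v≡ = trans (sym (pos-at (toℕ v))) eq
    m<k : m < k
    m<k = *-cancelˡ-< 2 m k (subst₂ _<_ v≡ 1+n≡2*k (≤-trans (toℕ<n v) (m≤n+m n 1)))

  open Bipartite {outs = SkOut k} side bipartite
    (λ j → trans (cong main (in-vertex j)) (proj₁ (partner-main (partner j))))
    (λ j → trans (cong main (out-vertex j)) (proj₂ (partner-main (partner j))))
    side-ins (≤-reflexive (sym 1+n≡2*k)) using (single-visit)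

theorem3 : (k : ℕ) → 4 ≤ k →
    IsInOut k (Sk-size k) (SkAdj k) (SkIn k) (SkOut k)
    × ((n : ℕ) (adj : Adj n) (ins outs : Fin k → Fin n) →
    IsInOut k n adj ins outs → Sk-size k ≤ n)
theorem3 (suc k) 4≤k = inOut , λ n adj ins outs io → s≤s⁻¹ (subst (_≤ suc n)
    (trans (cong (suc k +_) (sym (+-identityʳ (suc k)))) (sym (suc-Sk-size {suc k} (s≤s z≤n))))
    -- The index `zero` exists because `suc k` is positive; it selects the Hamiltonian path on which
    -- the counting is done.
    (LowerBound.2k≤1+n zero io))
  where
  inOut : IsInOut (suc k) (Sk-size (suc k)) (SkAdj (suc k)) (SkIn (suc k)) (SkOut (suc k))
  inOut with split-order k
  ... | p , t , eq = subst (λ k → IsInOut k (Sk-size k) (SkAdj k) (SkIn k) (SkOut k)) (sym eq)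
    (Sk-inOut p t (order-large p t (subst (4 ≤_) eq 4≤k)))
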